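{- Let $n\ge1$ and let $A\subseteq\{0,1\}^n$ be nonempty. Let $Y$ be the random variable defined as follows: choose $a\in A$ uniformly at random and run the simple random walk on $\{0,1\}^n$ started at $a$; $Y$ is the first time at which the walk is outside $A$. Then \[ \mathbb{E}\,Y\;\le\;\frac{n}{\log_2\!\left(\frac{2^n}{|A|}\right)} . \] Moreover, if $A$ is a subcube, equality holds. In particular, subcubes maximize the mean first exit time $\mathbb{E}Y$ among all subsets of $\{0,1\}^n$ of the same cardinality.
   Context: The discrete cube $\{0,1\}^n$ is the graph whose vertices are binary strings of length $n$, two being adjacent iff they differ in exactly one coordinate. The simple random walk moves at each step to a uniformly random one of the $n$ neighbors of the current vertex; the walk at time $0$ is at $a\in A$, so $Y\ge1$. A subcube is a set obtained by fixing the values of some subset of the coordinates and letting the others range freely. When $A=\{0,1\}^n$ both sides are interpreted as $+\infty$. -}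

module Defs where

open import Data.Bool using (Bool; true; false; not; if_then_else_)
open import Data.Nat using (ℕ; zero; suc; _+_; _*_; _∸_; _^_; _≤_; _<_)
open import Data.Fin using (Fin)
open import Data.Vec using (Vec; []; _∷_; updateAt; lookup)
open import Data.List using (List; []; _∷_; map; _++_; allFin; upTo)
open import Data.Nat.ListAction using (sum)
open import Data.Maybe using (Maybe; just; nothing)
open import Data.Product using (Σ; _×_; ∃)
open import Relation.Binary.PropositionalEquality using (_≡_)

Cube : ℕ → Set
Cube n = Vec Bool n

SubsetOf : ℕ → Set
SubsetOf n = Cube n → Bool

allCube : (n : ℕ) → List (Cube n)
allCube zero    = [] ∷ []
allCube (suc n) = map (false ∷_) (allCube n) ++ map (true ∷_) (allCube n)

sumCube : {n : ℕ} → (Cube n → ℕ) → ℕ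
sumCube {n} f = sum (map f (allCube n))

card : {n : ℕ} → SubsetOf n → ℕ
card A = sumCube (λ x → if A x then 1 else 0)

flipAt : {n : ℕ} → Fin n → Cube n → Cube n
flipAt i x = updateAt x i not

-- stay A t x = number of walks x = X₀, X₁, …, X_t of the simple random walk
-- (each step chooses one of the n coordinates to flip) with all X₀ … X_t ∈ A.
-- Hence P_x(Y > t) = stay A t x / n^t.
stay : {n : ℕ} → SubsetOf n → ℕ → Cube n → ℕ
stay A zero    x = if A x then 1 else 0
stay {n} A (suc t) x =
  if A x then sum (map (λ i → stay A t (flipAt i x)) (allFin n)) else 0

-- Partial sums of E Y = Σ_{t ≥ 0} P(Y > t), with a ∈ A uniform:
--   S_T = Σ_{t < T} (1/|A|) Σ_{a} stay A t a / n^t  =  num A T / den A T.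
num : {n : ℕ} → SubsetOf n → ℕ → ℕ
num {n} A T = sum (map (λ t → sumCube (stay A t) * n ^ (T ∸ t)) (upTo T))

den : {n : ℕ} → SubsetOf n → ℕ → ℕ
den {n} A T = card A * n ^ T

-- For q > 0, m > 0:  "p / q ≤ n / log₂ (2^n / m)"  (right side +∞ when m = 2^n).
-- With L = log₂(2^n/m) ≥ 0 this is p·L ≤ n·q, i.e. (2^n/m)^p ≤ 2^(n q),
-- i.e. 2^(n p) ≤ 2^(n q) · m^p (and it holds trivially when L = 0).
LeBound : (n m p q : ℕ) → Set
LeBound n m p q = 2 ^ (n * p) ≤ 2 ^ (n * q) * m ^ p

LtBound : (n m p q : ℕ) → Set
LtBound n m p q = 2 ^ (n * p) < 2 ^ (n * q) * m ^ p

-- E Y ≤ n / log₂(2^n/|A|) : every partial sum S_T is bounded by the bound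
-- (E Y is the supremum of the nondecreasing partial sums).
EY≤Bound : {n : ℕ} → SubsetOf n → Set
EY≤Bound {n} A = (T : ℕ) → LeBound n (card A) (num A T) (den A T)

-- E Y ≥ n / log₂(2^n/|A|) : every rational p/q (q > 0) strictly below the
-- bound is exceeded by some partial sum.
EY≥Bound : {n : ℕ} → SubsetOf n → Set
EY≥Bound {n} A = (p q : ℕ) → 0 < q → LtBound n (card A) p q →
  ∃ λ T → p * den A T < num A T * q

-- E_A Y ≤ E_B Y : every rational p/q exceeded by a partial sum for A is
-- exceeded by a partial sum for B.
EY≤EY : {n : ℕ} → SubsetOf n → SubsetOf n → Set
EY≤EY A B = (p q : ℕ) → 0 < q → (T : ℕ) → p * den A T < num A T * q →
  ∃ λ T′ → p * den B T′ < num B T′ * q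

inSubcube : {n : ℕ} → Vec (Maybe Bool) n → Cube n → Bool
inSubcube []             []      = true
inSubcube (nothing ∷ s)  (_ ∷ x) = inSubcube s x
inSubcube (just b ∷ s)   (c ∷ x) = if b then (if c then inSubcube s x else false)
                                            else (if c then false else inSubcube s x)

IsSubcube : {n : ℕ} → SubsetOf n → Set
IsSubcube {n} A = Σ (Vec (Maybe Bool) n) λ s → (x : Cube n) → A x ≡ inSubcube s x

{-# OPTIONS --safe #-}

-- For f ≥ 0 supported on A and μ = |A| / 2ⁿ one has (∑ f)² log₂ (1/μ) ≤ |A| · E(f), where E(f) is the
-- sum of (f x − f y)² over the edges xy.  Applied to f x = E_x[min(Y, T)], for which Green's identity and
-- n f ≤ n + (sum of f over the neighbours) on A give E(f) ≤ n ∑ f, this bounds ∑ f / |A| by n / log₂ (1/μ).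
-- The inequality is proved by induction on n, splitting the cube into two halves, with log₂ (1/μ) replaced
-- by each of its chords i + 2 − 2ⁱ⁺¹ μ between μ = 2⁻ⁱ and μ = 2⁻ⁱ⁻¹.  This is stronger than the inequality
-- with the logarithm, but it only involves integers, and the two-point inequality of the induction step
-- becomes a sum of squares.
-- On a subcube with k free coordinates the walk survives each step with probability k / n, so the exit time
-- is geometric.

module Submission where

open import Defs
open import Data.Bool using (Bool; true; false; not; if_then_else_)
open import Data.Fin using () renaming (suc to fsuc)
open import Data.List using (List; []; _∷_; map; _++_; allFin; upTo; applyUpTo)
open import Data.List.Properties using (map-∘; map-cong; map-++; map-tabulate; map-applyUpTo; map-upTo)
open import Data.Maybe using (Maybe; just; nothing)
import Data.Nat as ℕ
open import Data.Nat.ListAction using (sum)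
open import Data.Nat.ListAction.Properties using (sum-++)
open import Data.Product using (_×_; _,_; ∃; ∃₂)
open import Data.Sum using (_⊎_; inj₁; inj₂)
open import Data.Vec using (Vec; []; _∷_)
open import Function using (_∘_; id)
open import Relation.Binary.PropositionalEquality
open import Relation.Nullary using (yes; no)

-- Order lemmas over the integers and the two-point inequality.

module EnergyInequality where

  open import Data.Integer hiding (suc)
  open import Data.Integer.Properties
  open import Data.Integer.Tactic.RingSolver using (solve-∀)
  open import Data.Nat as ℕ using (ℕ; zero; suc)

  infixl 6 _⊕_
  infixl 7 _⊗_

  _⊕_ : ∀ {x y} → 0ℤ ≤ x → 0ℤ ≤ y → 0ℤ ≤ x + y
  _⊕_ = +-mono-≤

  _⊗_ : ∀ {x y} → 0ℤ ≤ x → 0ℤ ≤ y → 0ℤ ≤ x * y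
  _⊗_ {+ m} {+ n} _ _ = subst (0ℤ ≤_) (pos-* m n) (+≤+ ℕ.z≤n)

  0≤+ : ∀ {n} → 0ℤ ≤ + n
  0≤+ = +≤+ ℕ.z≤n

  0≤x*x : ∀ x → 0ℤ ≤ x * x
  0≤x*x (+ n)    = 0≤+ {n} ⊗ 0≤+ {n}
  0≤x*x -[1+ n ] = +≤+ ℕ.z≤n

  0≤-cancelˡ-* : ∀ {c x} → 0ℤ < c → 0ℤ ≤ c * x → 0ℤ ≤ x
  0≤-cancelˡ-* {c} {x} 0<c 0≤cx =
    *-cancelˡ-≤-pos 0ℤ x c {{positive 0<c}} (subst (_≤ c * x) (sym (*-zeroʳ c)) 0≤cx)

  -- If s² Λ ≤ a E then completing the square gives, for the slope c / d,
  -- (2 (c/d) s − (c/d)² a) Λ ≤ E.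
  linearise : ∀ a s Λ E c d → 0ℤ ≤ Λ → 0ℤ < a → 0ℤ ≤ a * E - s * s * Λ →
    0ℤ ≤ d * d * E - (+ 2 * (c * d * s) - c * c * a) * Λ
  linearise a s Λ E c d 0≤Λ 0<a h = 0≤-cancelˡ-* 0<a
    (subst (0ℤ ≤_) (eq a s Λ E c d) (0≤x*x d ⊗ h ⊕ 0≤Λ ⊗ 0≤x*x (d * s - c * a)))
    where
    eq : ∀ a s Λ E c d →
      d * d * (a * E - s * s * Λ) + Λ * ((d * s - c * a) * (d * s - c * a))
        ≡ a * (d * d * E - (+ 2 * (c * d * s) - c * c * a) * Λ)
    eq = solve-∀

  -- A half that misses the set has `a = s = 0`, so `a` cannot be cancelled; the subtracted term
  -- then vanishes and `E ≥ 0` suffices.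
  linearise-degenerate : ∀ a s Λ E c d → 0ℤ ≤ Λ → 0ℤ ≤ E → 0ℤ < a ⊎ (a ≡ 0ℤ × s ≡ 0ℤ) →
    0ℤ ≤ a * E - s * s * Λ →
    0ℤ ≤ d * d * E - (+ 2 * (c * d * s) - c * c * a) * Λ
  linearise-degenerate a s Λ E c d 0≤Λ _ (inj₁ 0<a) h = linearise a s Λ E c d 0≤Λ 0<a h
  linearise-degenerate _ _ Λ E c d _ 0≤E (inj₂ (refl , refl)) _ =
    subst (0ℤ ≤_) (eq Λ E c d) (0≤x*x d ⊗ 0≤E)
    where
    eq : ∀ Λ E c d → d * d * E ≡ d * d * E - (+ 2 * (c * d * 0ℤ) - c * c * 0ℤ) * Λ
    eq = solve-∀

  -- In the two-point inequality the halves of the cube have 2^N = K points each, and the parts of the set in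
  -- them have sizes a ≥ b, masses s, t, energies X₀ / K, X₁ / K and cross energy G; w = 2^i.
  two-point-from-deficit : ∀ K a b s t X₀ X₁ G B₀ B₁ Λ →
    0ℤ ≤ K → 0ℤ < a → 0ℤ < a + b →
    0ℤ ≤ (a + b) * (a + b) * X₀ - B₀ →
    0ℤ ≤ (a + b) * (a + b) * X₁ - B₁ →
    0ℤ ≤ a * G - (s - t) * (s - t) →
    0ℤ ≤ a * B₀ + a * B₁ + K * (((a + b) * (s - t)) * ((a + b) * (s - t)))
           - a * (a + b) * ((s + t) * (s + t)) * Λ →
    0ℤ ≤ (a + b) * (X₀ + X₁ + K * G) - (s + t) * (s + t) * Λ
  two-point-from-deficit K a b s t X₀ X₁ G B₀ B₁ Λ 0≤K 0<a 0<m u₀ u₁ v d =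
    -- The goal times `a * (a + b)` is `a` times the linearised bound of each half, plus
    -- `K * (a + b)²` times the cross-energy bound, plus the deficit `d`.
    0≤-cancelˡ-* 0<m (0≤-cancelˡ-* 0<a (subst (0ℤ ≤_)
      (eq K a (a + b) (s - t) X₀ X₁ G B₀ B₁ ((s + t) * (s + t)) Λ)
      (<⇒≤ 0<a ⊗ u₀ ⊕ <⇒≤ 0<a ⊗ u₁ ⊕ 0≤K ⊗ 0≤x*x (a + b) ⊗ v ⊕ d)))
    where
    eq : ∀ K a m r X₀ X₁ G B₀ B₁ Q Λ →
      a * (m * m * X₀ - B₀) + a * (m * m * X₁ - B₁) + K * (m * m) * (a * G - r * r)
        + (a * B₀ + a * B₁ + K * ((m * r) * (m * r)) - a * m * Q * Λ)
        ≡ a * (m * (m * (X₀ + X₁ + K * G) - Q * Λ))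
    eq = solve-∀

  -- Regime `w * a ≤ K`. Both halves are linearised on the same chord with slope
  -- `(s + t) / (a + b)`, the mean over the union. What is left combines the squares of
  -- `m * (s - t)` and `b * s - a * t` with weights `K - w * a` and `4 * w * a`.
  deficit-small : ∀ K w j a b s t → 0ℤ ≤ K - w * a → 0ℤ ≤ w → 0ℤ ≤ a →
    let m = a + b
        S = s + t in
    0ℤ ≤ a * ((+ 2 * (S * m * s) - S * S * a) * (j * K - + 2 * w * a))
         + a * ((+ 2 * (S * m * t) - S * S * b) * (j * K - + 2 * w * b))
         + K * ((m * (s - t)) * (m * (s - t)))
         - a * m * (S * S) * (j * K - w * m)
  deficit-small K w j a b s t h 0≤w 0≤a = subst (0ℤ ≤_) (eq K w j a b s t)
    (h ⊗ 0≤x*x ((a + b) * (s - t)) ⊕ 0≤+ {4} ⊗ (0≤w ⊗ 0≤a) ⊗ 0≤x*x (b * s - a * t))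
    where
    eq : ∀ K w j a b s t →
      (K - w * a) * (((a + b) * (s - t)) * ((a + b) * (s - t)))
        + + 4 * (w * a) * ((b * s - a * t) * (b * s - a * t))
      ≡ a * ((+ 2 * ((s + t) * (a + b) * s) - (s + t) * (s + t) * a) * (j * K - + 2 * w * a))
         + a * ((+ 2 * ((s + t) * (a + b) * t) - (s + t) * (s + t) * b) * (j * K - + 2 * w * b))
         + K * (((a + b) * (s - t)) * ((a + b) * (s - t)))
         - a * (a + b) * ((s + t) * (s + t)) * (j * K - w * (a + b))
    eq = solve-∀

  -- If `a ≥ 2 b` and `2 P ≤ b S`, the mixed term is absorbed into the product
  -- `(a - 2 b) S (b S - 2 P)` of nonnegative factors. If `b ≤ a ≤ 2 b`, completing the square in
  -- `4 P + (2 b - a) S` leaves a nonnegative multiple of `S²`.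
  quadratic-nonNeg : ∀ a b P S → 0ℤ ≤ a → 0ℤ ≤ b → 0ℤ ≤ S →
    (0ℤ ≤ a - + 2 * b × 0ℤ ≤ b * S - + 2 * P) ⊎ 0ℤ ≤ + 2 * b - a → 0ℤ ≤ a - b →
    0ℤ ≤ + 4 * (P * P) + (+ 4 * b - + 2 * a) * (P * S) + b * (+ 2 * a - b) * (S * S)
  quadratic-nonNeg a b P S 0≤a 0≤b 0≤S (inj₁ (h , k)) _ = subst (0ℤ ≤_) (eq a b P S)
    (0≤+ {4} ⊗ 0≤x*x P ⊕ h ⊗ 0≤S ⊗ k ⊕ 0≤b ⊗ (0≤a ⊕ 0≤b) ⊗ 0≤x*x S)
    where
    eq : ∀ a b P S →
      + 4 * (P * P) + (a - + 2 * b) * S * (b * S - + 2 * P) + b * (a + b) * (S * S)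
      ≡ + 4 * (P * P) + (+ 4 * b - + 2 * a) * (P * S) + b * (+ 2 * a - b) * (S * S)
    eq = solve-∀
  quadratic-nonNeg a b P S 0≤a 0≤b 0≤S (inj₂ h) k = 0≤-cancelˡ-* {+ 4} (+<+ (ℕ.s≤s ℕ.z≤n))
    (subst (0ℤ ≤_) (eq a b P S)
      (0≤x*x (+ 4 * P + (+ 2 * b - a) * S)
        ⊕ (0≤+ {8} ⊗ 0≤b ⊗ k ⊕ 0≤a ⊗ (0≤+ {2} ⊗ h ⊕ 0≤a)) ⊗ 0≤x*x S))
    where
    eq : ∀ a b P S →
      (+ 4 * P + (+ 2 * b - a) * S) * (+ 4 * P + (+ 2 * b - a) * S)
        + (+ 8 * b * (a - b) + a * (+ 2 * (+ 2 * b - a) + a)) * (S * S)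
      ≡ + 4 * (+ 4 * (P * P) + (+ 4 * b - + 2 * a) * (P * S) + b * (+ 2 * a - b) * (S * S))
    eq = solve-∀

  -- Regime `K ≤ w * a ≤ 2 K`, where the first half moves to the preceding chord. The deficit
  -- interpolates linearly between `4 K P²` at `w * a = K` and `K` times the quadratic form at
  -- `w * a = 2 K`.
  deficit-large : ∀ K w j a b s t → 0ℤ ≤ w * a - K → 0ℤ ≤ + 2 * K - w * a →
    let m = a + b
        S = s + t
        P = b * s - a * t in
    0ℤ ≤ + 4 * (P * P) + (+ 4 * b - + 2 * a) * (P * S) + b * (+ 2 * a - b) * (S * S) →
    0ℤ ≤ a * ((+ 2 * (S * m * s) - S * S * a) * (j * K - w * a))
         + a * ((+ 2 * (S * m * t) - S * S * b) * ((1ℤ + j) * K - + 2 * w * b))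
         + K * ((m * (s - t)) * (m * (s - t)))
         - a * m * (S * S) * ((1ℤ + j) * K - w * m)
  deficit-large K w j a b s t h k l = subst (0ℤ ≤_) (eq K w j a b s t)
    (k ⊗ (0≤+ {4} ⊗ 0≤x*x (b * s - a * t)) ⊕ h ⊗ l)
    where
    eq : ∀ K w j a b s t →
      (+ 2 * K - w * a) * (+ 4 * ((b * s - a * t) * (b * s - a * t)))
        + (w * a - K) * (+ 4 * ((b * s - a * t) * (b * s - a * t))
             + (+ 4 * b - + 2 * a) * ((b * s - a * t) * (s + t))
             + b * (+ 2 * a - b) * ((s + t) * (s + t)))
      ≡ a * ((+ 2 * ((s + t) * (a + b) * s) - (s + t) * (s + t) * a) * (j * K - w * a))
         + a * ((+ 2 * ((s + t) * (a + b) * t) - (s + t) * (s + t) * b) * ((1ℤ + j) * K - + 2 * w * b))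
         + K * (((a + b) * (s - t)) * ((a + b) * (s - t)))
         - a * (a + b) * ((s + t) * (s + t)) * ((1ℤ + j) * K - w * (a + b))
    eq = solve-∀

  -- With slope 0 the second half drops out. In terms of `R` the deficit is `K * R²`, plus a term
  -- linear in `R`, plus a term free of `R`, all with nonnegative coefficients.
  deficit-large-unbalanced : ∀ K w j a b s t → 0ℤ ≤ K → 0ℤ ≤ a → 0ℤ ≤ b → 0ℤ ≤ s + t →
    0ℤ ≤ w * (a + b) - K → 0ℤ ≤ j * K - w * a →
    0ℤ ≤ + 2 * (b * s - a * t) - b * (s + t) →
    let m = a + b
        S = s + t in
    0ℤ ≤ a * ((+ 2 * (S * m * s) - S * S * a) * (j * K - w * a))
         + a * ((+ 2 * (0ℤ * m * t) - 0ℤ * 0ℤ * b) * ((1ℤ + j) * K - + 2 * w * b))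
         + K * ((m * (s - t)) * (m * (s - t)))
         - a * m * (S * S) * ((1ℤ + j) * K - w * m)
  deficit-large-unbalanced K w j a b s t 0≤K 0≤a 0≤b 0≤S h k r = subst (0ℤ ≤_) (eq K w j a b s t)
    (0≤a ⊗ 0≤b ⊗ h ⊗ 0≤x*x (s + t) ⊕ 0≤a ⊗ r ⊗ 0≤S ⊗ (k ⊕ 0≤+ {2} ⊗ 0≤K) ⊕ 0≤K ⊗ 0≤x*x R)
    where
    R = + 2 * (b * s - a * t) - b * (s + t)
    eq : ∀ K w j a b s t →
      a * b * (w * (a + b) - K) * ((s + t) * (s + t))
        + a * (+ 2 * (b * s - a * t) - b * (s + t)) * (s + t) * ((j * K - w * a) + + 2 * K)
        + K * ((+ 2 * (b * s - a * t) - b * (s + t)) * (+ 2 * (b * s - a * t) - b * (s + t)))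
      ≡ a * ((+ 2 * ((s + t) * (a + b) * s) - (s + t) * (s + t) * a) * (j * K - w * a))
         + a * ((+ 2 * (0ℤ * (a + b) * t) - 0ℤ * 0ℤ * b) * ((1ℤ + j) * K - + 2 * w * b))
         + K * (((a + b) * (s - t)) * ((a + b) * (s - t)))
         - a * (a + b) * ((s + t) * (s + t)) * ((1ℤ + j) * K - w * (a + b))
    eq = solve-∀

  0≤1+ : ∀ {x} → 0ℤ ≤ x → 0ℤ ≤ 1ℤ + x
  0≤1+ h = 0≤+ {1} ⊕ h

  two-point-small : ∀ K w j a b s t X₀ X₁ G → 0ℤ ≤ K → 0ℤ ≤ w → 0ℤ ≤ j → 0ℤ < a → 0ℤ ≤ a - b →
    0ℤ < b ⊎ (b ≡ 0ℤ × t ≡ 0ℤ) → 0ℤ < a + b → 0ℤ ≤ X₁ → 0ℤ ≤ K - w * a →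
    0ℤ ≤ a * X₀ - s * s * ((+ 2 + j) * K - + 2 * w * a) →
    0ℤ ≤ b * X₁ - t * t * ((+ 2 + j) * K - + 2 * w * b) →
    0ℤ ≤ a * G - (s - t) * (s - t) →
    0ℤ ≤ (a + b) * (X₀ + X₁ + K * G) - (s + t) * (s + t) * ((+ 2 + j) * K - w * (a + b))
  two-point-small K w j a b s t X₀ X₁ G 0≤K 0≤w 0≤j 0<a b≤a b? 0<m 0≤X₁ h l₀ l₁ v =
    two-point-from-deficit K a b s t X₀ X₁ G _ _ _ 0≤K 0<a 0<m
      (linearise a s _ X₀ (s + t) (a + b) 0≤Λ₀ 0<a l₀)
      (linearise-degenerate b t _ X₁ (s + t) (a + b) 0≤Λ₁ 0≤X₁ b? l₁)
      v (deficit-small K w (+ 2 + j) a b s t h 0≤w (<⇒≤ 0<a))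
    where
    eq₀ : ∀ K w j a → j * K + + 2 * (K - w * a) ≡ (+ 2 + j) * K - + 2 * w * a
    eq₀ = solve-∀
    eq₁ : ∀ K w j a b → j * K + + 2 * ((K - w * a) + w * (a - b)) ≡ (+ 2 + j) * K - + 2 * w * b
    eq₁ = solve-∀
    -- `linearise` needs nonnegative chord values; both follow from `w * b ≤ w * a ≤ K` and `j ≥ 0`.
    0≤Λ₀ = subst (0ℤ ≤_) (eq₀ K w j a) (0≤j ⊗ 0≤K ⊕ 0≤+ {2} ⊗ h)
    0≤Λ₁ = subst (0ℤ ≤_) (eq₁ K w j a b) (0≤j ⊗ 0≤K ⊕ 0≤+ {2} ⊗ (h ⊕ 0≤w ⊗ b≤a))

  0≤-total : ∀ x y → 0ℤ ≤ y - x ⊎ 0ℤ ≤ x - y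
  0≤-total x y with ≤-total x y
  ... | inj₁ x≤y = inj₁ (i≤j⇒0≤j-i x≤y)
  ... | inj₂ y≤x = inj₂ (i≤j⇒0≤j-i y≤x)

  -- When 2 (b s − a t) > b (s + t) and a > 2 b the second half carries so little mass that only X₁ ≥ 0 is
  -- used there (slope 0 in linearise).
  two-point-large : ∀ K w j a b s t X₀ X₁ G → 0ℤ ≤ K → 0ℤ ≤ w → 0ℤ ≤ j → 0ℤ < a → 0ℤ ≤ b → 0ℤ ≤ a - b →
    0ℤ < b ⊎ (b ≡ 0ℤ × t ≡ 0ℤ) → 0ℤ < a + b → 0ℤ ≤ X₁ → 0ℤ ≤ s + t →
    0ℤ ≤ w * a - K → 0ℤ ≤ + 2 * K - w * (a + b) →
    0ℤ ≤ a * X₀ - s * s * ((+ 2 + j) * K - w * a) →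
    0ℤ ≤ b * X₁ - t * t * ((1ℤ + (+ 2 + j)) * K - + 2 * w * b) →
    0ℤ ≤ a * G - (s - t) * (s - t) →
    0ℤ ≤ (a + b) * (X₀ + X₁ + K * G)
           - (s + t) * (s + t) * ((1ℤ + (+ 2 + j)) * K - w * (a + b))
  two-point-large K w j a b s t X₀ X₁ G 0≤K 0≤w 0≤j 0<a 0≤b b≤a b? 0<m 0≤X₁ 0≤S h k l₀ l₁ v
    with 0≤-total (+ 2 * (b * s - a * t)) (b * (s + t)) | 0≤-total (+ 2 * b) a
  ... | P≷ | b≷ = result P≷ b≷
    where
    eq₀ : ∀ K w j a b → j * K + (+ 2 * K - w * (a + b)) + w * b ≡ (+ 2 + j) * K - w * a
    eq₀ = solve-∀
    eq₁ : ∀ K w j a b → (1ℤ + j) * K + + 2 * ((+ 2 * K - w * (a + b)) + (w * a - K))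
      ≡ (1ℤ + (+ 2 + j)) * K - + 2 * w * b
    eq₁ = solve-∀
    eq₂ : ∀ K w a b → (+ 2 * K - w * (a + b)) + w * b ≡ + 2 * K - w * a
    eq₂ = solve-∀
    eq₃ : ∀ K w a b → (w * a - K) + w * b ≡ w * (a + b) - K
    eq₃ = solve-∀
    0≤Λ₀ = subst (0ℤ ≤_) (eq₀ K w j a b) (0≤j ⊗ 0≤K ⊕ k ⊕ 0≤w ⊗ 0≤b)
    0≤Λ₁ = subst (0ℤ ≤_) (eq₁ K w j a b) (0≤1+ 0≤j ⊗ 0≤K ⊕ 0≤+ {2} ⊗ (k ⊕ h))
    wa≤2K = subst (0ℤ ≤_) (eq₂ K w a b) (k ⊕ 0≤w ⊗ 0≤b)
    Goal = 0ℤ ≤ (a + b) * (X₀ + X₁ + K * G)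
           - (s + t) * (s + t) * ((1ℤ + (+ 2 + j)) * K - w * (a + b))
    u₀ = linearise a s _ X₀ (s + t) (a + b) 0≤Λ₀ 0<a l₀

    withQuadratic : (0ℤ ≤ a - + 2 * b × 0ℤ ≤ b * (s + t) - + 2 * (b * s - a * t)) ⊎ 0ℤ ≤ + 2 * b - a → Goal
    withQuadratic c = two-point-from-deficit K a b s t X₀ X₁ G _ _ _ 0≤K 0<a 0<m u₀
      (linearise-degenerate b t _ X₁ (s + t) (a + b) 0≤Λ₁ 0≤X₁ b? l₁) v
      (deficit-large K w (+ 2 + j) a b s t h wa≤2K
        (quadratic-nonNeg a b (b * s - a * t) (s + t) (<⇒≤ 0<a) 0≤b 0≤S c b≤a))

    result : 0ℤ ≤ b * (s + t) - + 2 * (b * s - a * t) ⊎ 0ℤ ≤ + 2 * (b * s - a * t) - b * (s + t) →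
      0ℤ ≤ a - + 2 * b ⊎ 0ℤ ≤ + 2 * b - a → Goal
    result _        (inj₂ q) = withQuadratic (inj₂ q)
    result (inj₁ p) (inj₁ q) = withQuadratic (inj₁ (q , p))
    result (inj₂ p) (inj₁ _) = two-point-from-deficit K a b s t X₀ X₁ G _ _ _ 0≤K 0<a 0<m u₀
      (linearise-degenerate b t _ X₁ 0ℤ (a + b) 0≤Λ₁ 0≤X₁ b? l₁) v
      (deficit-large-unbalanced K w (+ 2 + j) a b s t 0≤K (<⇒≤ 0<a) 0≤b 0≤S
        (subst (0ℤ ≤_) (eq₃ K w a b) (h ⊕ 0≤w ⊗ 0≤b)) 0≤Λ₀ p)

  -- When w (a + b) ≥ 2 K, the preceding chord is the better one.
  two-point : ∀ K w j a b s t X₀ X₁ G → 0ℤ ≤ K → 0ℤ ≤ w → 0ℤ ≤ j → 0ℤ < a → 0ℤ ≤ b → 0ℤ ≤ a - b →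
    0ℤ < b ⊎ (b ≡ 0ℤ × t ≡ 0ℤ) → 0ℤ < a + b → 0ℤ ≤ X₁ → 0ℤ ≤ s + t →
    0ℤ ≤ a * X₀ - s * s * ((1ℤ + (+ 2 + j)) * K - + 2 * w * a) →
    0ℤ ≤ b * X₁ - t * t * ((1ℤ + (+ 2 + j)) * K - + 2 * w * b) →
    0ℤ ≤ a * X₀ - s * s * ((+ 2 + j) * K - w * a) →
    0ℤ ≤ + 2 * ((a + b) * (X₀ + X₁ + K * G)) - (s + t) * (s + t) * ((+ 2 + j) * (+ 2 * K) - w * (a + b)) →
    0ℤ ≤ a * G - (s - t) * (s - t) →
    0ℤ ≤ (a + b) * (X₀ + X₁ + K * G)
           - (s + t) * (s + t) * ((1ℤ + (+ 2 + j)) * K - w * (a + b))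
  two-point K w j a b s t X₀ X₁ G 0≤K 0≤w 0≤j 0<a 0≤b b≤a b? 0<m 0≤X₁ 0≤S l₀ l₁ l₀′ l v
    -- Three regimes: the larger half has density at most `1 / w`; it is denser than that but the
    -- union is not; the union is denser too.
    with 0≤-total (w * a) K | 0≤-total (w * (a + b)) (+ 2 * K)
  ... | inj₁ wa≤K | _ =
    subst (λ i → 0ℤ ≤ (a + b) * (X₀ + X₁ + K * G) - (s + t) * (s + t) * (i * K - w * (a + b))) (eq j)
      (two-point-small K w (1ℤ + j) a b s t X₀ X₁ G 0≤K 0≤w (0≤1+ 0≤j) 0<a b≤a b? 0<m 0≤X₁ wa≤K
        (subst (λ i → 0ℤ ≤ a * X₀ - s * s * (i * K - + 2 * w * a)) (sym (eq j)) l₀)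
        (subst (λ i → 0ℤ ≤ b * X₁ - t * t * (i * K - + 2 * w * b)) (sym (eq j)) l₁) v)
    where
    eq : ∀ j → + 2 + (1ℤ + j) ≡ 1ℤ + (+ 2 + j)
    eq = solve-∀
  ... | inj₂ wa≥K | inj₁ wm≤2K =
    two-point-large K w j a b s t X₀ X₁ G 0≤K 0≤w 0≤j 0<a 0≤b b≤a b? 0<m 0≤X₁ 0≤S wa≥K wm≤2K l₀′ l₁ v
  ... | inj₂ _ | inj₂ wm≥2K = 0≤-cancelˡ-* {+ 2} (+<+ (ℕ.s≤s ℕ.z≤n))
    (subst (0ℤ ≤_) (eq ((a + b) * (X₀ + X₁ + K * G)) ((s + t) * (s + t)) K w j (a + b))
      (l ⊕ 0≤x*x (s + t) ⊗ wm≥2K))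
    where
    eq : ∀ Y Q K w j m →
      + 2 * Y - Q * ((+ 2 + j) * (+ 2 * K) - w * m) + Q * (w * m - + 2 * K)
      ≡ + 2 * (Y - Q * ((1ℤ + (+ 2 + j)) * K - w * m))
    eq = solve-∀

  -- Sums, energy and Cauchy-Schwarz on the cube.

  ∑ : ∀ {n} → (Cube n → ℤ) → ℤ
  ∑ {zero}  f = f []
  ∑ {suc n} f = ∑ (f ∘ (false ∷_)) + ∑ (f ∘ (true ∷_))

  size : ∀ {n} → SubsetOf n → ℤ
  size A = ∑ λ x → if A x then 1ℤ else 0ℤ

  crossEnergy : ∀ {n} → (f g : Cube n → ℤ) → ℤ
  crossEnergy f g = ∑ λ x → (f x - g x) * (f x - g x)

  -- Recursive in the first coordinate, like `∑`, so that splitting into halves is definitional. The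
  -- last summand runs over the edges in that direction, so each edge counts once.
  energy : ∀ {n} → (Cube n → ℤ) → ℤ
  energy {zero}  f = 0ℤ
  energy {suc n} f =
    energy (f ∘ (false ∷_)) + energy (f ∘ (true ∷_)) + crossEnergy (f ∘ (false ∷_)) (f ∘ (true ∷_))

  NonNeg : ∀ {n} → (Cube n → ℤ) → Set
  NonNeg f = ∀ x → 0ℤ ≤ f x

  SupportedOn : ∀ {n} → SubsetOf n → (Cube n → ℤ) → Set
  SupportedOn A f = ∀ x → A x ≡ false → f x ≡ 0ℤ

  ∑-cong : ∀ {n} {f g : Cube n → ℤ} → (∀ x → f x ≡ g x) → ∑ f ≡ ∑ g
  ∑-cong {zero}  h = h []
  ∑-cong {suc n} h = cong₂ _+_ (∑-cong (h ∘ (false ∷_))) (∑-cong (h ∘ (true ∷_)))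

  ∑-nonNeg : ∀ {n} {f : Cube n → ℤ} → NonNeg f → 0ℤ ≤ ∑ f
  ∑-nonNeg {zero}  h = h []
  ∑-nonNeg {suc n} h = ∑-nonNeg (h ∘ (false ∷_)) ⊕ ∑-nonNeg (h ∘ (true ∷_))

  ∑-*ˡ : ∀ {n} c (f : Cube n → ℤ) → ∑ (λ x → c * f x) ≡ c * ∑ f
  ∑-*ˡ {zero}  c f = refl
  ∑-*ˡ {suc n} c f = trans (cong₂ _+_ (∑-*ˡ c (f ∘ (false ∷_))) (∑-*ˡ c (f ∘ (true ∷_))))
    (sym (*-distribˡ-+ c _ _))

  ∑-+ : ∀ {n} (f g : Cube n → ℤ) → ∑ (λ x → f x + g x) ≡ ∑ f + ∑ g
  ∑-+ {zero}  f g = refl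
  ∑-+ {suc n} f g = trans (cong₂ _+_ (∑-+ (f ∘ (false ∷_)) (g ∘ (false ∷_))) (∑-+ (f ∘ (true ∷_)) (g ∘ (true ∷_))))
    (eq (∑ (f ∘ (false ∷_))) (∑ (g ∘ (false ∷_))) (∑ (f ∘ (true ∷_))) (∑ (g ∘ (true ∷_))))
    where
    eq : ∀ a b c d → a + b + (c + d) ≡ a + c + (b + d)
    eq = solve-∀

  ∑-mono : ∀ {n} {f g : Cube n → ℤ} → (∀ x → f x ≤ g x) → ∑ f ≤ ∑ g
  ∑-mono {zero}  h = h []
  ∑-mono {suc n} h = +-mono-≤ (∑-mono (h ∘ (false ∷_))) (∑-mono (h ∘ (true ∷_)))

  ∑-linear : ∀ {n} p q r (u v w : Cube n → ℤ) →
    ∑ (λ x → p * u x + q * v x + r * w x) ≡ p * ∑ u + q * ∑ v + r * ∑ w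
  ∑-linear p q r u v w = trans (∑-+ (λ x → p * u x + q * v x) (λ x → r * w x)) (cong₂ _+_
    (trans (∑-+ (λ x → p * u x) (λ x → q * v x)) (cong₂ _+_ (∑-*ˡ p u) (∑-*ˡ q v))) (∑-*ˡ r w))

  energy-nonNeg : ∀ {n} (f : Cube n → ℤ) → 0ℤ ≤ energy f
  energy-nonNeg {zero}  f = ≤-refl
  energy-nonNeg {suc n} f =
    energy-nonNeg (f ∘ (false ∷_)) ⊕ energy-nonNeg (f ∘ (true ∷_))
      ⊕ ∑-nonNeg (λ x → 0≤x*x (f (false ∷ x) - f (true ∷ x)))

  size-nonNeg : ∀ {n} (A : SubsetOf n) → 0ℤ ≤ size A
  size-nonNeg A = ∑-nonNeg λ x → ind-nonNeg (A x)
    where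
    ind-nonNeg : ∀ b → 0ℤ ≤ (if b then 1ℤ else 0ℤ)
    ind-nonNeg true  = 0≤+
    ind-nonNeg false = 0≤+

  sum≡0⇒≡0 : ∀ {x y} → 0ℤ ≤ x → 0ℤ ≤ y → x + y ≡ 0ℤ → x ≡ 0ℤ × y ≡ 0ℤ
  sum≡0⇒≡0 {+ zero} {+ zero} _ _ _ = refl , refl
  sum≡0⇒≡0 {+ zero} {+ suc _} _ _ ()
  sum≡0⇒≡0 {+ suc _} {+ _} _ _ ()

  size≡0⇒∑≡0 : ∀ {n} (A : SubsetOf n) f → SupportedOn A f → size A ≡ 0ℤ → ∑ f ≡ 0ℤ
  size≡0⇒∑≡0 {zero} A f sup eq with A [] in A[]
  ... | false = sup [] A[]
  size≡0⇒∑≡0 {suc n} A f sup eq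
    with sum≡0⇒≡0 (size-nonNeg (A ∘ (false ∷_))) (size-nonNeg (A ∘ (true ∷_))) eq
  ... | e₀ , e₁ = cong₂ _+_ (size≡0⇒∑≡0 _ _ (sup ∘ (false ∷_)) e₀) (size≡0⇒∑≡0 _ _ (sup ∘ (true ∷_)) e₁)

  size-dichotomy : ∀ {n} (A : SubsetOf n) f → SupportedOn A f → 0ℤ < size A ⊎ (size A ≡ 0ℤ × ∑ f ≡ 0ℤ)
  size-dichotomy A f sup with 0ℤ ≟ size A
  ... | yes eq = inj₂ (sym eq , size≡0⇒∑≡0 A f sup (sym eq))
  ... | no neq = inj₁ (≤∧≢⇒< (size-nonNeg A) neq)

  -- Sum over the cube the square of `a * g - σ` on `A` and of `a * g` off `A`; the total is `a`
  -- times the claim.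
  cauchySchwarz : ∀ {n} (A : SubsetOf n) (g : Cube n → ℤ) → 0ℤ < size A →
    let σ = ∑ λ x → if A x then g x else 0ℤ in
    0ℤ ≤ size A * ∑ (λ x → g x * g x) - σ * σ
  cauchySchwarz {n} A g 0<a = 0≤-cancelˡ-* 0<a
    (subst (0ℤ ≤_) (trans (∑-linear {n} (a * a) (- (+ 2 * (a * σ))) (σ * σ) (λ x → g x * g x)
                            (λ x → if A x then g x else 0ℤ) (λ x → if A x then 1ℤ else 0ℤ))
                          (eq a σ (∑ (λ x → g x * g x))))
      (∑-nonNeg λ x → pointwise (A x) (g x)))
    where
    a = size A
    σ = ∑ λ x → if A x then g x else 0ℤ
    eq : ∀ a σ G → a * a * G + - (+ 2 * (a * σ)) * σ + σ * σ * a ≡ a * (a * G - σ * σ)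
    eq = solve-∀
    eqᵗ : ∀ a σ y → (a * y - σ) * (a * y - σ)
      ≡ a * a * (y * y) + - (+ 2 * (a * σ)) * y + σ * σ * 1ℤ
    eqᵗ = solve-∀
    eqᶠ : ∀ a σ y → (a * y) * (a * y) ≡ a * a * (y * y) + - (+ 2 * (a * σ)) * 0ℤ + σ * σ * 0ℤ
    eqᶠ = solve-∀
    pointwise : ∀ b y → 0ℤ ≤ a * a * (y * y) + - (+ 2 * (a * σ)) * (if b then y else 0ℤ)
                               + σ * σ * (if b then 1ℤ else 0ℤ)
    pointwise true  y = subst (0ℤ ≤_) (eqᵗ a σ y) (0≤x*x (a * y - σ))
    pointwise false y = subst (0ℤ ≤_) (eqᶠ a σ y) (0≤x*x (a * y))

  -- Outside A the difference f − g is nonpositive, so its sum over A alone is already at least ∑ f − ∑ g.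
  crossEnergy-bound : ∀ {n} (A : SubsetOf n) (f g : Cube n → ℤ) → 0ℤ < size A → SupportedOn A f → NonNeg g →
    0ℤ ≤ ∑ f - ∑ g → 0ℤ ≤ size A * crossEnergy f g - (∑ f - ∑ g) * (∑ f - ∑ g)
  crossEnergy-bound {n} A f g 0<a sup 0≤g r = subst (0ℤ ≤_) (eq (size A * crossEnergy f g) σ (∑ f - ∑ g))
    -- With `d = ∑ f - ∑ g`, `σ² - d²` is the product of `σ - d` and `(σ - d) + 2 d`.
    (cauchySchwarz A (λ x → f x - g x) 0<a ⊕ excess ⊗ (excess ⊕ 0≤+ {2} ⊗ r))
    where
    σ = ∑ λ x → if A x then f x - g x else 0ℤ
    eq : ∀ Y σ d → Y - σ * σ + (σ - d) * (σ - d + + 2 * d) ≡ Y - d * d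
    eq = solve-∀
    eqᵗ : ∀ y z → 0ℤ ≡ 1ℤ * (y - z) + -1ℤ * y + 1ℤ * z
    eqᵗ = solve-∀
    eqᶠ : ∀ z → z ≡ 1ℤ * 0ℤ + -1ℤ * 0ℤ + 1ℤ * z
    eqᶠ = solve-∀
    eq∑ : ∀ σ s t → 1ℤ * σ + -1ℤ * s + 1ℤ * t ≡ σ - (s - t)
    eq∑ = solve-∀
    pointwise : ∀ x → 0ℤ ≤ 1ℤ * (if A x then f x - g x else 0ℤ) + -1ℤ * f x + 1ℤ * g x
    pointwise x with A x in Ax
    ... | true  = ≤-reflexive (eqᵗ (f x) (g x))
    ... | false rewrite sup x Ax = subst (0ℤ ≤_) (eqᶠ (g x)) (0≤g x)
    excess : 0ℤ ≤ σ - (∑ f - ∑ g)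
    excess = subst (0ℤ ≤_)
      (trans (∑-linear {n} 1ℤ -1ℤ 1ℤ (λ x → if A x then f x - g x else 0ℤ) f g) (eq∑ σ (∑ f) (∑ g)))
      (∑-nonNeg pointwise)

  crossEnergy-sym : ∀ {n} (f g : Cube n → ℤ) → crossEnergy f g ≡ crossEnergy g f
  crossEnergy-sym f g = ∑-cong λ x → eq (f x) (g x)
    where
    eq : ∀ y z → (y - z) * (y - z) ≡ (z - y) * (z - y)
    eq = solve-∀

  crossEnergy-nonNeg : ∀ {n} (f g : Cube n → ℤ) → 0ℤ ≤ crossEnergy f g
  crossEnergy-nonNeg f g = ∑-nonNeg λ x → 0≤x*x (f x - g x)

  -- Whichever of `f` and `g` has the larger sum supplies the bound with the size of its own set,
  -- and `size A` is the larger size. If `B` is empty then `∑ g = 0`, and `f` can always take that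
  -- role.
  crossEnergy-bound-larger : ∀ {n} (A B : SubsetOf n) (f g : Cube n → ℤ) →
    SupportedOn A f → SupportedOn B g → NonNeg f → NonNeg g →
    0ℤ < size A → 0ℤ ≤ size A - size B →
    0ℤ ≤ size A * crossEnergy f g - (∑ f - ∑ g) * (∑ f - ∑ g)
  crossEnergy-bound-larger A B f g supA supB 0≤f 0≤g 0<a b≤a with 0≤-total (∑ g) (∑ f)
  ... | inj₁ t≤s = crossEnergy-bound A f g 0<a supA 0≤g t≤s
  ... | inj₂ s≤t with size-dichotomy B g supB
  ...   | inj₁ 0<b = subst (0ℤ ≤_) (eq (size A) (size B) (∑ f) (∑ g) (crossEnergy f g))
            (subst (λ G → 0ℤ ≤ size B * G - (∑ g - ∑ f) * (∑ g - ∑ f)) (crossEnergy-sym g f)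
               (crossEnergy-bound B g f 0<b supB 0≤f s≤t)
             ⊕ b≤a ⊗ crossEnergy-nonNeg f g)
    where
    eq : ∀ a b s t G → b * G - (t - s) * (t - s) + (a - b) * G ≡ a * G - (s - t) * (s - t)
    eq = solve-∀
  ...   | inj₂ (_ , t≡0) = crossEnergy-bound A f g 0<a supA 0≤g
            (subst (λ t → 0ℤ ≤ ∑ f - t) (sym t≡0) (∑-nonNeg 0≤f ⊕ ≤-refl))

  -- Induction on the dimension along the chords of the logarithm.

  pow : ℕ → ℤ
  pow zero    = 1ℤ
  pow (suc k) = + 2 * pow k

  pow≡ : ∀ k → pow k ≡ + (2 ℕ.^ k)
  pow≡ zero    = refl
  pow≡ (suc k) = trans (cong (+ 2 *_) (pow≡ k)) (sym (pos-* 2 (2 ℕ.^ k)))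

  pow-nonNeg : ∀ k → 0ℤ ≤ pow k
  pow-nonNeg zero    = 0≤+
  pow-nonNeg (suc k) = 0≤+ {2} ⊗ pow-nonNeg k

  size≤pow : ∀ {n} (A : SubsetOf n) → 0ℤ ≤ pow n - size A
  size≤pow {zero}  A with A []
  ... | true  = ≤-refl
  ... | false = 0≤+
  size≤pow {suc n} A = subst (0ℤ ≤_)
    (eq (pow n) (size (A ∘ (false ∷_))) (size (A ∘ (true ∷_))))
    (size≤pow (A ∘ (false ∷_)) ⊕ size≤pow (A ∘ (true ∷_)))
    where
    eq : ∀ K a b → (K - a) + (K - b) ≡ + 2 * K - (a + b)
    eq = solve-∀

  -- With μ = size A / 2ⁿ and c = 2 + i: (∑ f)² (c − 2ⁱ⁺¹ μ) ≤ size A · energy f, where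
  -- μ ↦ c − 2ⁱ⁺¹ μ is the chord of μ ↦ log₂ (1 / μ) between 2⁻ⁱ and 2⁻ⁱ⁻¹.
  Chord : ∀ {n} → ℕ → SubsetOf n → (Cube n → ℤ) → Set
  Chord {n} i A f =
    0ℤ ≤ size A * (pow n * energy f) - ∑ f * ∑ f * (+ (2 ℕ.+ i) * pow n - + 2 * pow i * size A)

  -- `Chord i` for the union of the halves, divided by 2: doubling restores `pow (suc n)` and the
  -- slope `+ 2 * pow i`.
  HalvesChord : ∀ {n} → ℕ → (A B : SubsetOf n) → (f g : Cube n → ℤ) → Set
  HalvesChord {n} i A B f g =
    0ℤ ≤ (size A + size B) * (pow n * energy f + pow n * energy g + pow n * crossEnergy f g)
           - (∑ f + ∑ g) * (∑ f + ∑ g) * (+ (2 ℕ.+ i) * pow n - pow i * (size A + size B))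

  -- Chord i for the union, not divided by 2, so that it has the slope pow (suc i) of HalvesChord (suc i).
  HalvesChord′ : ∀ {n} → ℕ → (A B : SubsetOf n) → (f g : Cube n → ℤ) → Set
  HalvesChord′ {n} i A B f g =
    0ℤ ≤ + 2 * ((size A + size B) * (pow n * energy f + pow n * energy g + pow n * crossEnergy f g))
           - (∑ f + ∑ g) * (∑ f + ∑ g) * (+ (2 ℕ.+ i) * (+ 2 * pow n) - pow (suc i) * (size A + size B))

  HalvesChord-sym : ∀ {n} i (A B : SubsetOf n) f g → HalvesChord i B A g f → HalvesChord i A B f g
  HalvesChord-sym {n} i A B f g h rewrite crossEnergy-sym g f = subst (0ℤ ≤_)
    (eq (pow n) (pow i) (+ (2 ℕ.+ i)) (size A) (size B) (∑ f) (∑ g) (energy f) (energy g) (crossEnergy f g)) h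
    where
    eq : ∀ K w c a b s t E F G →
      (b + a) * (K * F + K * E + K * G) - (t + s) * (t + s) * (c * K - w * (b + a))
      ≡ (a + b) * (K * E + K * F + K * G) - (s + t) * (s + t) * (c * K - w * (a + b))
    eq = solve-∀

  HalvesChord⇒Chord : ∀ {n} i (A : SubsetOf (suc n)) f →
    HalvesChord i (A ∘ (false ∷_)) (A ∘ (true ∷_)) (f ∘ (false ∷_)) (f ∘ (true ∷_)) → Chord i A f
  HalvesChord⇒Chord {n} i A f h = subst (0ℤ ≤_)
    (eq (pow n) (pow i) (+ (2 ℕ.+ i)) (size A) (∑ f)
      (energy (f ∘ (false ∷_))) (energy (f ∘ (true ∷_))) (crossEnergy (f ∘ (false ∷_)) (f ∘ (true ∷_))))
    (0≤+ {2} ⊗ h)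
    where
    eq : ∀ K w c m S E F G →
      + 2 * (m * (K * E + K * F + K * G) - S * S * (c * K - w * m))
      ≡ m * (+ 2 * K * (E + F + G)) - S * S * (c * (+ 2 * K) - + 2 * w * m)
    eq = solve-∀

  larger-pos : ∀ {a b} → 0ℤ ≤ a → 0ℤ ≤ b → 0ℤ < a + b → 0ℤ ≤ a - b → 0ℤ < a
  larger-pos {+ suc _} _ _ _ _ = +<+ (ℕ.s≤s ℕ.z≤n)
  larger-pos {+ zero} {+ zero} _ _ (+<+ ()) _
  larger-pos {+ zero} {+ suc _} _ _ _ ()

  module _ {n} (A B : SubsetOf n) (f g : Cube n → ℤ)
    (supA : SupportedOn A f) (supB : SupportedOn B g) (0≤f : NonNeg f) (0≤g : NonNeg g)
    (0<m : 0ℤ < size A + size B) (b≤a : 0ℤ ≤ size A - size B) where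

    private
      K = pow n
      a = size A
      b = size B
      E = energy f
      F = energy g
      G = crossEnergy f g
      0<a : 0ℤ < a
      0<a = larger-pos (size-nonNeg A) (size-nonNeg B) 0<m b≤a
      0≤KF : 0ℤ ≤ K * F
      0≤KF = pow-nonNeg n ⊗ energy-nonNeg g
      v = crossEnergy-bound-larger A B f g supA supB 0≤f 0≤g 0<a b≤a

    -- Here `w = 1`, and `size A ≤ pow n` always puts the larger half in the regime of
    -- `two-point-small`.
    halves-zero : Chord 0 A f → Chord 0 B g → HalvesChord 0 A B f g
    halves-zero h₀ h₁ = two-point-small K 1ℤ 0ℤ a b (∑ f) (∑ g) (K * E) (K * F) G
      (pow-nonNeg n) 0≤+ ≤-refl 0<a b≤a (size-dichotomy B g supB) 0<m 0≤KF
      (subst (λ z → 0ℤ ≤ K - z) (sym (*-identityˡ a)) (size≤pow A)) h₀ h₁ v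

    -- `Chord i` has slope `+ 2 * pow i`, which is `pow (suc i)` by definition, so it serves as the
    -- preceding chord of `two-point` at `w = pow (suc i)`.
    halves-suc : ∀ i → Chord (suc i) A f → Chord (suc i) B g → Chord i A f →
      HalvesChord′ i A B f g → HalvesChord (suc i) A B f g
    halves-suc i h₀ h₁ h₀′ h = two-point K (pow (suc i)) (+ i) a b (∑ f) (∑ g) (K * E) (K * F) G
      (pow-nonNeg n) (pow-nonNeg (suc i)) 0≤+ 0<a (size-nonNeg B) b≤a (size-dichotomy B g supB) 0<m 0≤KF
      (∑-nonNeg 0≤f ⊕ ∑-nonNeg 0≤g) h₀ h₁
      h₀′ h v

  Chord⇒HalvesChord′ : ∀ {n} i (A : SubsetOf (suc n)) f → Chord i A f →
    HalvesChord′ i (A ∘ (false ∷_)) (A ∘ (true ∷_)) (f ∘ (false ∷_)) (f ∘ (true ∷_))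
  Chord⇒HalvesChord′ {n} i A f h = subst (0ℤ ≤_)
    (eq (pow n) (pow i) (+ (2 ℕ.+ i)) (size A) (∑ f)
      (energy (f ∘ (false ∷_))) (energy (f ∘ (true ∷_))) (crossEnergy (f ∘ (false ∷_)) (f ∘ (true ∷_)))) h
    where
    eq : ∀ K w c m S E F G →
      m * (+ 2 * K * (E + F + G)) - S * S * (c * (+ 2 * K) - + 2 * w * m)
      ≡ + 2 * (m * (K * E + K * F + K * G)) - S * S * (c * (+ 2 * K) - + 2 * w * m)
    eq = solve-∀

  HalvesChord′-sym : ∀ {n} i (A B : SubsetOf n) f g → HalvesChord′ i A B f g → HalvesChord′ i B A g f
  HalvesChord′-sym {n} i A B f g h rewrite crossEnergy-sym f g = subst (0ℤ ≤_)
    (eq (pow n) (pow (suc i)) (+ (2 ℕ.+ i)) (size A) (size B) (∑ f) (∑ g) (energy f) (energy g) (crossEnergy g f)) h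
    where
    eq : ∀ K w c a b s t E F G →
      + 2 * ((a + b) * (K * E + K * F + K * G)) - (s + t) * (s + t) * (c * (+ 2 * K) - w * (a + b))
      ≡ + 2 * ((b + a) * (K * F + K * E + K * G)) - (t + s) * (t + s) * (c * (+ 2 * K) - w * (b + a))
    eq = solve-∀

  module _ {n} (A B : SubsetOf n) (f g : Cube n → ℤ)
    (supA : SupportedOn A f) (supB : SupportedOn B g) (0≤f : NonNeg f) (0≤g : NonNeg g)
    (0<m : 0ℤ < size A + size B) where

    private
      0<m′ = subst (0ℤ <_) (+-comm (size A) (size B)) 0<m

    -- The claim is symmetric in the halves, so the larger one may come first.
    combine-zero : Chord 0 A f → Chord 0 B g → HalvesChord 0 A B f g
    combine-zero h₀ h₁ with 0≤-total (size B) (size A)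
    ... | inj₁ b≤a = halves-zero A B f g supA supB 0≤f 0≤g 0<m b≤a h₀ h₁
    ... | inj₂ a≤b = HalvesChord-sym 0 A B f g
      (halves-zero B A g f supB supA 0≤g 0≤f 0<m′ a≤b h₁ h₀)

    combine-suc : ∀ i → Chord (suc i) A f → Chord (suc i) B g → Chord i A f → Chord i B g →
      HalvesChord′ i A B f g → HalvesChord (suc i) A B f g
    combine-suc i h₀ h₁ h₀′ h₁′ h with 0≤-total (size B) (size A)
    ... | inj₁ b≤a = halves-suc A B f g supA supB 0≤f 0≤g 0<m b≤a i h₀ h₁ h₀′ h
    ... | inj₂ a≤b = HalvesChord-sym (suc i) A B f g
      (halves-suc B A g f supB supA 0≤g 0≤f 0<m′ a≤b i h₁ h₀ h₁′ (HalvesChord′-sym i A B f g h))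

  -- This is the base of the induction: on an occupied one-point cube the energy is 0, so every
  -- chord has to be nonpositive at `μ = 1`.
  2+i≤2^[1+i] : ∀ i → 0ℤ ≤ + 2 * pow i - + (2 ℕ.+ i)
  2+i≤2^[1+i] zero    = ≤-refl
  2+i≤2^[1+i] (suc i) = subst (0ℤ ≤_) (eq (pow i) (+ i))
    (0≤+ {2} ⊗ 2+i≤2^[1+i] i ⊕ 0≤1+ (0≤+ {i}))
    where
    eq : ∀ w j → + 2 * (+ 2 * w - (+ 2 + j)) + (1ℤ + j) ≡ + 2 * (+ 2 * w) - (+ 2 + (1ℤ + j))
    eq = solve-∀

  -- Induction on the dimension and, within a dimension, on the chord index. For an empty `A` both
  -- sides are 0; this case is split off because the induction step cancels the size.
  chord : ∀ n i (A : SubsetOf n) f → NonNeg f → SupportedOn A f → Chord i A f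
  chord-inhabited : ∀ n i (A : SubsetOf n) f → NonNeg f → SupportedOn A f → 0ℤ < size A → Chord i A f

  chord n i A f 0≤f sup with size-dichotomy A f sup
  ... | inj₁ 0<m = chord-inhabited n i A f 0≤f sup 0<m
  ... | inj₂ (m≡0 , S≡0) rewrite m≡0 | S≡0 = ≤-refl

  chord-inhabited zero i A f 0≤f sup 0<m with A []
  ... | true = subst (0ℤ ≤_) (eq (pow i) (+ (2 ℕ.+ i)) (f []))
    (0≤x*x (f []) ⊗ 2+i≤2^[1+i] i)
    where
    eq : ∀ w c y → y * y * (+ 2 * w - c) ≡ 1ℤ * (1ℤ * 0ℤ) - y * y * (c * 1ℤ - + 2 * w * 1ℤ)
    eq = solve-∀
  chord-inhabited zero i A f 0≤f sup (+<+ ()) | false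
  chord-inhabited (suc n) zero A f 0≤f sup 0<m = HalvesChord⇒Chord 0 A f
    (combine-zero (A ∘ (false ∷_)) (A ∘ (true ∷_)) (f ∘ (false ∷_)) (f ∘ (true ∷_))
      (sup ∘ (false ∷_)) (sup ∘ (true ∷_)) (0≤f ∘ (false ∷_)) (0≤f ∘ (true ∷_)) 0<m
      (chord n 0 _ _ (0≤f ∘ (false ∷_)) (sup ∘ (false ∷_)))
      (chord n 0 _ _ (0≤f ∘ (true ∷_)) (sup ∘ (true ∷_))))
  chord-inhabited (suc n) (suc i) A f 0≤f sup 0<m = HalvesChord⇒Chord (suc i) A f
    (combine-suc (A ∘ (false ∷_)) (A ∘ (true ∷_)) (f ∘ (false ∷_)) (f ∘ (true ∷_))
      (sup ∘ (false ∷_)) (sup ∘ (true ∷_)) (0≤f ∘ (false ∷_)) (0≤f ∘ (true ∷_)) 0<m i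
      (chord n (suc i) _ _ (0≤f ∘ (false ∷_)) (sup ∘ (false ∷_)))
      (chord n (suc i) _ _ (0≤f ∘ (true ∷_)) (sup ∘ (true ∷_)))
      (chord n i _ _ (0≤f ∘ (false ∷_)) (sup ∘ (false ∷_)))
      (chord n i _ _ (0≤f ∘ (true ∷_)) (sup ∘ (true ∷_)))
      -- The preceding chord for the whole set, in the same dimension, covers the regime where the
      -- union is too dense for chord `suc i`.
      (Chord⇒HalvesChord′ i A f (chord-inhabited (suc n) i A f 0≤f sup 0<m)))

-- Truncated exit times, Green's identity and the energy of the walk.

module Walk where

  open EnergyInequality
  open import Data.Integer as ℤ using (ℤ; +_; 0ℤ; 1ℤ)
  import Data.Integer.Properties as ℤ
  open import Data.Integer.Tactic.RingSolver using (solve-∀)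
  open import Data.Nat
  open import Data.Nat.Properties

  neighbours : ∀ {n} → (Cube n → ℕ) → Cube n → ℕ
  neighbours {n} f x = sum (map (λ i → f (flipAt i x)) (allFin n))

  neighbours-∷ : ∀ {n} (f : Cube (suc n) → ℕ) b x →
    neighbours f (b ∷ x) ≡ f (not b ∷ x) + neighbours (f ∘ (b ∷_)) x
  neighbours-∷ f b x = cong (λ l → f (not b ∷ x) + sum l)
    (trans (map-tabulate fsuc (λ i → f (flipAt i (b ∷ x))))
           (sym (map-tabulate id (λ i → f (b ∷ flipAt i x)))))

  sum-map-≤ : ∀ {A : Set} {f g : A → ℕ} (l : List A) → (∀ x → f x ≤ g x) → sum (map f l) ≤ sum (map g l)
  sum-map-≤ []      h = z≤n
  sum-map-≤ (x ∷ l) h = +-mono-≤ (h x) (sum-map-≤ l h)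

  sum-map-*ʳ : ∀ {A : Set} (f : A → ℕ) c (l : List A) → sum (map (λ x → f x * c) l) ≡ sum (map f l) * c
  sum-map-*ʳ f c []      = refl
  sum-map-*ʳ f c (x ∷ l) = trans (cong₂ _+_ (refl {x = f x * c}) (sum-map-*ʳ f c l)) (sym (*-distribʳ-+ c (f x) _))

  sum-map-zero : ∀ {A : Set} (l : List A) → sum (map (λ _ → 0) l) ≡ 0
  sum-map-zero []      = refl
  sum-map-zero (x ∷ l) = sum-map-zero l

  sum-map-+ : ∀ {A : Set} (f g : A → ℕ) (l : List A) →
    sum (map (λ x → f x + g x) l) ≡ sum (map f l) + sum (map g l)
  sum-map-+ f g []      = refl
  sum-map-+ f g (x ∷ l) = trans (cong₂ _+_ (refl {x = f x + g x}) (sum-map-+ f g l))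
    (interchange (f x) (g x) _ _)
    where open import Algebra.Properties.CommutativeSemigroup +-commutativeSemigroup using (interchange)

  sum-map-swap : ∀ {A B : Set} (f : A → B → ℕ) (l : List A) (l′ : List B) →
    sum (map (λ x → sum (map (f x) l′)) l) ≡ sum (map (λ y → sum (map (λ x → f x y) l)) l′)
  sum-map-swap f []      l′ = sym (sum-map-zero l′)
  sum-map-swap f (x ∷ l) l′ = trans (cong₂ _+_ (refl {x = sum (map (f x) l′)}) (sum-map-swap f l l′))
    (sym (sum-map-+ (f x) _ l′))

  -- visits A T x = n^T · E_x[min(Y, T)].
  visits : ∀ {n} → SubsetOf n → ℕ → Cube n → ℕ
  visits     A zero    x = 0
  visits {n} A (suc T) x = if A x then n ^ suc T + neighbours (visits A T) x else 0

  -- This is `E[min(Y, T)] = Σ P(Y > t)` over `t < T`, scaled by `n ^ T`. The term `t = 0` is peeled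
  -- off, the remaining times are shifted by the first step, and the sums over directions and times
  -- are exchanged.
  visits≡ : ∀ {n} (A : SubsetOf n) T x →
    visits A T x ≡ sum (map (λ t → stay A t x * n ^ (T ∸ t)) (upTo T))
  visits≡     A zero    x = refl
  visits≡ {n} A (suc T) x = trans step
    (cong (λ l → stay A 0 x * n ^ suc T + sum l)
      (trans (map-upTo (λ t → stay A (suc t) x * n ^ (T ∸ t)) T)
             (sym (map-applyUpTo suc (λ t → stay A t x * n ^ (suc T ∸ t)) T))))
    where
    step : visits A (suc T) x
      ≡ stay A 0 x * n ^ suc T + sum (map (λ t → stay A (suc t) x * n ^ (T ∸ t)) (upTo T))
    step with A x
    ... | false = sym (sum-map-zero (upTo T))
    ... | true  = cong₂ _+_ (sym (*-identityˡ (n ^ suc T))) (begin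
      sum (map (λ i → visits A T (flipAt i x)) (allFin n))
        ≡⟨ cong sum (map-cong (λ i → visits≡ A T (flipAt i x)) (allFin n)) ⟩
      sum (map (λ i → sum (map (λ t → stay A t (flipAt i x) * n ^ (T ∸ t)) (upTo T))) (allFin n))
        ≡⟨ sum-map-swap (λ i t → stay A t (flipAt i x) * n ^ (T ∸ t)) (allFin n) (upTo T) ⟩
      sum (map (λ t → sum (map (λ i → stay A t (flipAt i x) * n ^ (T ∸ t)) (allFin n))) (upTo T))
        ≡⟨ cong sum (map-cong (λ t → sum-map-*ʳ (λ i → stay A t (flipAt i x)) _ (allFin n)) (upTo T)) ⟩
      sum (map (λ t → neighbours (stay A t) x * n ^ (T ∸ t)) (upTo T)) ∎)
      where open ≡-Reasoning

  sumCube-visits : ∀ {n} (A : SubsetOf n) T → sumCube (visits A T) ≡ num A T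
  sumCube-visits {n} A T = begin
    sumCube (visits A T)
      ≡⟨ cong sum (map-cong (visits≡ A T) (allCube n)) ⟩
    sumCube (λ x → sum (map (λ t → stay A t x * n ^ (T ∸ t)) (upTo T)))
      ≡⟨ sum-map-swap (λ x t → stay A t x * n ^ (T ∸ t)) (allCube n) (upTo T) ⟩
    sum (map (λ t → sumCube (λ x → stay A t x * n ^ (T ∸ t))) (upTo T))
      ≡⟨ cong sum (map-cong (λ t → sum-map-*ʳ (stay A t) _ (allCube n)) (upTo T)) ⟩
    num A T ∎
    where open ≡-Reasoning

  -- Monotonicity of `E[min(Y, T)]` in `T`. On `A` the right side unfolds by one step, which bounds
  -- the Laplacian of `visits A T` there by `n ^ suc T`.
  visits-grow : ∀ {n} (A : SubsetOf n) T x → visits A T x * n ≤ visits A (suc T) x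
  visits-grow     A zero    x = z≤n
  visits-grow {n} A (suc T) x with A x
  ... | false = z≤n
  ... | true  = begin
    (n ^ suc T + neighbours (visits A T) x) * n
      ≡⟨ *-distribʳ-+ n (n ^ suc T) _ ⟩
    n ^ suc T * n + neighbours (visits A T) x * n
      ≡⟨ cong₂ _+_ (*-comm (n ^ suc T) n) (sym (sum-map-*ʳ (λ i → visits A T (flipAt i x)) n (allFin n))) ⟩
    n ^ suc (suc T) + sum (map (λ i → visits A T (flipAt i x) * n) (allFin n))
      ≤⟨ +-monoʳ-≤ (n ^ suc (suc T)) (sum-map-≤ (allFin n) (λ i → visits-grow A T (flipAt i x))) ⟩
    n ^ suc (suc T) + neighbours (visits A (suc T)) x ∎
    where open ≤-Reasoning

  sumCube-∷ : ∀ {n} (f : Cube (suc n) → ℕ) →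
    sumCube f ≡ sumCube (f ∘ (false ∷_)) + sumCube (f ∘ (true ∷_))
  sumCube-∷ {n} f = begin
    sum (map f (map (false ∷_) l ++ map (true ∷_) l))
      ≡⟨ cong sum (map-++ f (map (false ∷_) l) _) ⟩
    sum (map f (map (false ∷_) l) ++ map f (map (true ∷_) l))
      ≡⟨ sum-++ (map f (map (false ∷_) l)) _ ⟩
    sum (map f (map (false ∷_) l)) + sum (map f (map (true ∷_) l))
      ≡⟨ cong₂ _+_ (cong sum (sym (map-∘ l))) (cong sum (sym (map-∘ l))) ⟩
    sumCube (f ∘ (false ∷_)) + sumCube (f ∘ (true ∷_)) ∎
    where
    open ≡-Reasoning
    l = allCube n

  ∑-pos : ∀ {n} (f : Cube n → ℕ) → ∑ (+_ ∘ f) ≡ + sumCube f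
  ∑-pos {zero}  f = cong +_ (sym (+-identityʳ (f [])))
  ∑-pos {suc n} f = trans (cong₂ ℤ._+_ (∑-pos (f ∘ (false ∷_))) (∑-pos (f ∘ (true ∷_))))
    (cong +_ (sym (sumCube-∷ f)))

  size≡card : ∀ {n} (A : SubsetOf n) → size A ≡ + card A
  size≡card A = trans (∑-cong λ x → ind (A x)) (∑-pos λ x → if A x then 1 else 0)
    where
    ind : ∀ b → (if b then 1ℤ else 0ℤ) ≡ + (if b then 1 else 0)
    ind true  = refl
    ind false = refl

  laplacian : ∀ {n} → (Cube n → ℕ) → Cube n → ℤ
  laplacian {n} f x = + n ℤ.* + f x ℤ.- + neighbours f x

  -- Summation by parts: an edge `xy` contributes `f x (f x - f y) + f y (f y - f x) = (f x - f
  -- y)²`.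
  green : ∀ {n} (f : Cube n → ℕ) → ∑ (λ x → + f x ℤ.* laplacian f x) ≡ energy (+_ ∘ f)
  green {zero}  f = ℤ.*-zeroʳ (+ f [])
  green {suc n} f = begin
    ∑ (λ x → + f (false ∷ x) ℤ.* laplacian f (false ∷ x)) ℤ.+ ∑ (λ x → + f (true ∷ x) ℤ.* laplacian f (true ∷ x))
      ≡⟨ ∑-+ (λ x → + f (false ∷ x) ℤ.* laplacian f (false ∷ x)) (λ x → + f (true ∷ x) ℤ.* laplacian f (true ∷ x)) ⟨
    ∑ (λ x → + f (false ∷ x) ℤ.* laplacian f (false ∷ x) ℤ.+ + f (true ∷ x) ℤ.* laplacian f (true ∷ x))
      ≡⟨ ∑-cong pointwise ⟩
    ∑ (λ x → + f₀ x ℤ.* laplacian f₀ x ℤ.+ + f₁ x ℤ.* laplacian f₁ x ℤ.+ (+ f₀ x ℤ.- + f₁ x) ℤ.* (+ f₀ x ℤ.- + f₁ x))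
      ≡⟨ ∑-+ (λ x → + f₀ x ℤ.* laplacian f₀ x ℤ.+ + f₁ x ℤ.* laplacian f₁ x) _ ⟩
    ∑ (λ x → + f₀ x ℤ.* laplacian f₀ x ℤ.+ + f₁ x ℤ.* laplacian f₁ x) ℤ.+ crossEnergy (+_ ∘ f₀) (+_ ∘ f₁)
      ≡⟨ cong (ℤ._+ crossEnergy (+_ ∘ f₀) (+_ ∘ f₁)) (trans (∑-+ (λ x → + f₀ x ℤ.* laplacian f₀ x) _)
           (cong₂ ℤ._+_ (green f₀) (green f₁))) ⟩
    energy (+_ ∘ f) ∎
    where
    open ≡-Reasoning
    f₀ f₁ : Cube n → ℕ
    f₀ = f ∘ (false ∷_)
    f₁ = f ∘ (true ∷_)
    eq : ∀ N y z p q →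
      y ℤ.* ((1ℤ ℤ.+ N) ℤ.* y ℤ.- (z ℤ.+ p)) ℤ.+ z ℤ.* ((1ℤ ℤ.+ N) ℤ.* z ℤ.- (y ℤ.+ q))
      ≡ y ℤ.* (N ℤ.* y ℤ.- p) ℤ.+ z ℤ.* (N ℤ.* z ℤ.- q) ℤ.+ (y ℤ.- z) ℤ.* (y ℤ.- z)
    eq = solve-∀
    pointwise : ∀ x → + f (false ∷ x) ℤ.* laplacian f (false ∷ x) ℤ.+ + f (true ∷ x) ℤ.* laplacian f (true ∷ x)
      ≡ + f₀ x ℤ.* laplacian f₀ x ℤ.+ + f₁ x ℤ.* laplacian f₁ x ℤ.+ (+ f₀ x ℤ.- + f₁ x) ℤ.* (+ f₀ x ℤ.- + f₁ x)
    pointwise x = trans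
      (cong₂ (λ p q → + f₀ x ℤ.* (+ suc n ℤ.* + f₀ x ℤ.- + p) ℤ.+ + f₁ x ℤ.* (+ suc n ℤ.* + f₁ x ℤ.- + q))
        (neighbours-∷ f false x) (neighbours-∷ f true x))
      (eq (+ n) (+ f₀ x) (+ f₁ x) (+ neighbours f₀ x) (+ neighbours f₁ x))

  visits-off : ∀ {n} (A : SubsetOf n) T x → A x ≡ false → visits A T x ≡ 0
  visits-off A zero    x Ax = refl
  visits-off A (suc T) x Ax rewrite Ax = refl

  -- By `green` the energy is the sum of `f` times its Laplacian. On `A` the Laplacian is at most
  -- `n ^ suc T`; off `A` the function `f` vanishes.
  energy-visits : ∀ {n} (A : SubsetOf n) T →
    energy (+_ ∘ visits A T) ℤ.≤ + (n ^ suc T) ℤ.* ∑ (+_ ∘ visits A T)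
  energy-visits {n} A T = subst₂ ℤ._≤_
    (green (visits A T)) (∑-*ˡ (+ (n ^ suc T)) (+_ ∘ visits A T)) (∑-mono pointwise)
    where
    on : ∀ x → A x ≡ true → visits A T x * n ≤ n ^ suc T + neighbours (visits A T) x
    on x Ax with visits-grow A T x
    ... | h rewrite Ax = h
    rearrange : ∀ N y C p → y * N ≤ C + p → + y ℤ.* (+ N ℤ.* + y ℤ.- + p) ℤ.≤ + C ℤ.* + y
    rearrange N y C p h = ℤ.0≤i-j⇒j≤i (subst (0ℤ ℤ.≤_) (eq (+ N) (+ y) (+ C) (+ p))
      (0≤+ {y} ⊗ ℤ.i≤j⇒0≤j-i (subst (ℤ._≤ + C ℤ.+ + p) (ℤ.pos-* y N) (ℤ.+≤+ h))))
      where
      eq : ∀ N y C p → y ℤ.* (C ℤ.+ p ℤ.- y ℤ.* N) ≡ C ℤ.* y ℤ.- y ℤ.* (N ℤ.* y ℤ.- p)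
      eq = solve-∀
    pointwise : ∀ x → + visits A T x ℤ.* laplacian (visits A T) x ℤ.≤ + (n ^ suc T) ℤ.* + visits A T x
    pointwise x with A x in Ax
    ... | true  = rearrange n (visits A T x) (n ^ suc T) _ (on x Ax)
    ... | false rewrite visits-off A T x Ax | ℤ.*-zeroʳ (+ (n ^ suc T)) = ℤ.≤-refl

  drop-pos : ∀ m s C P W c →
    0ℤ ℤ.≤ + m ℤ.* + P ℤ.* + C ℤ.- + s ℤ.* (+ c ℤ.* + P ℤ.- + 2 ℤ.* + W ℤ.* + m) →
    s * (c * P) ≤ m * P * C + s * (2 * W * m)
  drop-pos m s C P W c h = ℤ.drop‿+≤+ (subst₂ ℤ._≤_
    (sym (trans (ℤ.pos-* s (c * P)) (cong (+ s ℤ.*_) (ℤ.pos-* c P))))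
    (sym (cong₂ ℤ._+_
      (trans (ℤ.pos-* (m * P) C) (cong (ℤ._* + C) (ℤ.pos-* m P)))
      (trans (ℤ.pos-* s (2 * W * m))
        (cong (+ s ℤ.*_) (trans (ℤ.pos-* (2 * W) m) (cong (ℤ._* + m) (ℤ.pos-* 2 W)))))))
    (ℤ.0≤i-j⇒j≤i (subst (0ℤ ℤ.≤_) (eq (+ m) (+ s) (+ C) (+ P) (+ W) (+ c)) h)))
    where
    eq : ∀ m s C P W c → m ℤ.* P ℤ.* C ℤ.- s ℤ.* (c ℤ.* P ℤ.- + 2 ℤ.* W ℤ.* m)
      ≡ m ℤ.* P ℤ.* C ℤ.+ s ℤ.* (+ 2 ℤ.* W ℤ.* m) ℤ.- s ℤ.* (c ℤ.* P)
    eq = solve-∀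

  -- `chord` bounds a multiple of `s²` by the energy and `energy-visits` bounds the energy by a
  -- multiple of `s`, where `s = num A T`; a positive `s` is then cancelled.
  num-chord : ∀ n i (A : SubsetOf n) T →
    num A T * ((2 + i) * 2 ^ n) ≤ card A * 2 ^ n * n ^ suc T + num A T * (2 * 2 ^ i * card A)
  num-chord n i A T with num A T in numA
  ... | zero    = z≤n
  ... | s@(suc _) = drop-pos (card A) s (n ^ suc T) (2 ^ n) (2 ^ i) (2 + i)
    (0≤-cancelˡ-* {+ s} (ℤ.+<+ (s≤s z≤n)) (subst (0ℤ ℤ.≤_)
      (eq (+ card A) (+ (2 ^ n)) (energy f) (+ (n ^ suc T)) (+ s)
          (+ (2 + i) ℤ.* + (2 ^ n) ℤ.- + 2 ℤ.* + (2 ^ i) ℤ.* + card A))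
      (0≤+ {card A} ⊗ 0≤+ {2 ^ n} ⊗ ℤ.i≤j⇒0≤j-i energy≤ ⊕ chord′)))
    where
    f : Cube n → ℤ
    f = +_ ∘ visits A T
    ∑f≡s : ∑ f ≡ + s
    ∑f≡s = trans (∑-pos (visits A T)) (cong +_ (trans (sumCube-visits A T) numA))
    energy≤ : energy f ℤ.≤ + (n ^ suc T) ℤ.* + s
    energy≤ = subst (λ S → energy f ℤ.≤ + (n ^ suc T) ℤ.* S) ∑f≡s (energy-visits A T)
    chord′ : 0ℤ ℤ.≤ + card A ℤ.* (+ (2 ^ n) ℤ.* energy f)
      ℤ.- + s ℤ.* + s ℤ.* (+ (2 + i) ℤ.* + (2 ^ n) ℤ.- + 2 ℤ.* + (2 ^ i) ℤ.* + card A)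
    chord′ with chord n i A f (λ _ → 0≤+) (λ x Ax → cong +_ (visits-off A T x Ax))
    ... | h rewrite ∑f≡s | size≡card A | pow≡ n | pow≡ i = h
    eq : ∀ m P E C S Λ → m ℤ.* P ℤ.* (C ℤ.* S ℤ.- E) ℤ.+ (m ℤ.* (P ℤ.* E) ℤ.- S ℤ.* S ℤ.* Λ)
      ≡ S ℤ.* (m ℤ.* P ℤ.* C ℤ.- S ℤ.* Λ)
    eq = solve-∀

-- Chords of the binary logarithm over the naturals, and the upper bound.

open import Data.Nat
open import Data.Nat.Properties
open import Data.Nat.Tactic.RingSolver using (solve-∀)
open Walk using (neighbours; neighbours-∷; sum-map-*ʳ; sum-map-zero; sumCube-∷; num-chord)

^-distribʳ-* : ∀ a b k → (a * b) ^ k ≡ a ^ k * b ^ k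
^-distribʳ-* a b zero    = refl
^-distribʳ-* a b (suc k) rewrite ^-distribʳ-* a b k = eq a b (a ^ k) (b ^ k)
  where
  eq : ∀ a b x y → a * b * (x * y) ≡ a * x * (b * y)
  eq = solve-∀

^-cancelˡ-≤ : ∀ k .{{_ : NonZero k}} {a b} → a ^ k ≤ b ^ k → a ≤ b
^-cancelˡ-≤ k h = ≮⇒≥ λ b<a → <⇒≱ (^-monoˡ-< k b<a) h

^-cancelʳ-≤ : ∀ {a b} → 2 ^ a ≤ 2 ^ b → a ≤ b
^-cancelʳ-≤ h = ≮⇒≥ λ b<a → <⇒≱ (^-monoʳ-< 2 (s≤s (s≤s z≤n)) b<a) h

half : ∀ m → ∃ λ c → m ≡ c * 2 ⊎ m ≡ suc (c * 2)
half zero = 0 , inj₁ refl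
half (suc m) with half m
... | c , inj₁ eq = c , inj₂ (cong suc eq)
... | c , inj₂ eq = suc c , inj₁ (cong suc eq)

-- Since `4 u v ≤ m²`, `log₂ m` is at least 1 plus the average of `log₂ u` and `log₂ v`. Averaging
-- the two affine lower bounds and adding 1 gives the bound at level `suc k`.
log₂-chord-midpoint : ∀ k u v m → u + v ≡ m → u * v * 4 ≤ m * m →
  2 ^ (k * 2 ^ k + u) ≤ u ^ (2 ^ k) * 2 ^ (2 ^ k) →
  2 ^ (k * 2 ^ k + v) ≤ v ^ (2 ^ k) * 2 ^ (2 ^ k) →
  2 ^ (suc k * 2 ^ suc k + m) ≤ m ^ (2 ^ suc k) * 2 ^ (2 ^ suc k)
log₂-chord-midpoint k u v m refl 4uv≤m² hu hv = begin
  2 ^ (suc k * (2 * M) + (u + v))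
    ≡⟨ cong (2 ^_) (exponent k M u v) ⟩
  2 ^ ((k * M + u + (k * M + v)) + 2 * M)
    ≡⟨ ^-distribˡ-+-* 2 (k * M + u + (k * M + v)) (2 * M) ⟩
  2 ^ (k * M + u + (k * M + v)) * 2 ^ (2 * M)
    ≡⟨ cong (_* 2 ^ (2 * M)) (^-distribˡ-+-* 2 (k * M + u) (k * M + v)) ⟩
  2 ^ (k * M + u) * 2 ^ (k * M + v) * 2 ^ (2 * M)
    ≤⟨ *-monoˡ-≤ (2 ^ (2 * M)) (*-mono-≤ hu hv) ⟩
  (u ^ M * 2 ^ M) * (v ^ M * 2 ^ M) * 2 ^ (2 * M)
    ≡⟨ cong (_* 2 ^ (2 * M)) (cong₂ _*_ (^-distribʳ-* u 2 M) (^-distribʳ-* v 2 M)) ⟨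
  (u * 2) ^ M * (v * 2) ^ M * 2 ^ (2 * M)
    ≡⟨ cong (_* 2 ^ (2 * M)) (^-distribʳ-* (u * 2) (v * 2) M) ⟨
  (u * 2 * (v * 2)) ^ M * 2 ^ (2 * M)
    ≡⟨ cong (λ z → z ^ M * 2 ^ (2 * M)) (fourfold u v) ⟩
  (u * v * 4) ^ M * 2 ^ (2 * M)
    ≤⟨ *-monoˡ-≤ (2 ^ (2 * M)) (^-monoˡ-≤ M 4uv≤m²) ⟩
  (m * m) ^ M * 2 ^ (2 * M)
    ≡⟨ cong (λ z → (m * z) ^ M * 2 ^ (2 * M)) (*-identityʳ m) ⟨
  (m ^ 2) ^ M * 2 ^ (2 * M)
    ≡⟨ cong (_* 2 ^ (2 * M)) (^-*-assoc m 2 M) ⟩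
  m ^ (2 * M) * 2 ^ (2 * M) ∎
  where
  open ≤-Reasoning
  M = 2 ^ k
  exponent : ∀ k M u v → suc k * (2 * M) + (u + v) ≡ k * M + u + (k * M + v) + 2 * M
  exponent = solve-∀
  fourfold : ∀ u v → u * 2 * (v * 2) ≡ u * v * 4
  fourfold = solve-∀

-- log₂ m ≥ k − 1 + m / 2ᵏ, the chord of log₂ between 2ᵏ and 2ᵏ⁺¹, by midpoint concavity.
log₂-chord : ∀ k m → 2 ^ k ≤ m → m ≤ 2 ^ suc k → 2 ^ (k * 2 ^ k + m) ≤ m ^ (2 ^ k) * 2 ^ (2 ^ k)
log₂-chord zero zero () _
log₂-chord zero 1 _ _ = ≤-refl
log₂-chord zero 2 _ _ = ≤-refl
log₂-chord zero (suc (suc (suc _))) _ (s≤s (s≤s ()))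
log₂-chord (suc k) m l u with half m
... | c , inj₁ refl = log₂-chord-midpoint k c c (c * 2) (sum-eq c) (≤-reflexive (prod-eq c)) h h
  where
  sum-eq : ∀ c → c + c ≡ c * 2
  sum-eq = solve-∀
  prod-eq : ∀ c → c * c * 4 ≡ c * 2 * (c * 2)
  prod-eq = solve-∀
  h = log₂-chord k c
    (*-cancelˡ-≤ 2 (≤-trans l (≤-reflexive (*-comm c 2))))
    (*-cancelˡ-≤ 2 (≤-trans (≤-reflexive (*-comm 2 c)) u))
-- An odd `m` splits into `c` and `suc c`; as the endpoints of the interval for `m` are even, both
-- parts stay in the halved interval.
... | c , inj₂ refl = log₂-chord-midpoint k c (suc c) (suc (c * 2)) (sum-eq c)
  (≤-trans (n≤1+n _) (≤-reflexive (prod-eq c)))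
  (log₂-chord k c 2^k≤c (<⇒≤ c<2^1+k)) (log₂-chord k (suc c) (m≤n⇒m≤1+n 2^k≤c) c<2^1+k)
  where
  sum-eq : ∀ c → c + suc c ≡ suc (c * 2)
  sum-eq = solve-∀
  prod-eq : ∀ c → suc (c * suc c * 4) ≡ suc (c * 2) * suc (c * 2)
  prod-eq = solve-∀
  suc-double : ∀ c → suc (suc (c * 2)) ≡ 2 * suc c
  suc-double = solve-∀
  2^k≤c : 2 ^ k ≤ c
  2^k≤c = s≤s⁻¹ (*-cancelˡ-< 2 (2 ^ k) (suc c) (≤-trans (s≤s l) (≤-reflexive (suc-double c))))
  c<2^1+k : c < 2 ^ suc k
  c<2^1+k = *-cancelˡ-< 2 c (2 ^ suc k) (≤-trans (≤-reflexive (cong suc (*-comm 2 c))) u)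

-- Selects the chord: the density `m / 2 ^ n` lies between `2⁻ⁱ⁻¹` and `2⁻ⁱ`.
dyadic-range : ∀ n m → 1 ≤ m → m < 2 ^ n →
  ∃₂ λ k i → n ≡ suc (i + k) × 2 ^ k ≤ m × m ≤ 2 ^ suc k
dyadic-range zero    (suc m) _ (s≤s ())
dyadic-range (suc n) m 1≤m m<2^1+n with m <? 2 ^ n
... | no  m≮2^n = n , 0 , refl , ≮⇒≥ m≮2^n , <⇒≤ m<2^1+n
... | yes m<2^n with dyadic-range n m 1≤m m<2^n
...   | k , i , n≡ , l , u = k , suc i , cong suc n≡ , l , u

-- By `log₂-chord`, `n - log₂ m ≤ 2 + i - m / 2 ^ k` for `n = suc (i + k)`, so the chord estimate
-- implies the one with the logarithm.
chord⇒LeBound : ∀ i k m p q → 2 ^ k ≤ m → m ≤ 2 ^ suc k →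
  p * ((2 + i) * 2 ^ k) ≤ suc (i + k) * q * 2 ^ k + p * m → LeBound (suc (i + k)) m p q
-- The power `M = 2 ^ k` clears the denominator of `m / 2 ^ k`; the factor `2 ^ (M * p)` matches the
-- factor `2 ^ (2 ^ k)` in `log₂-chord`.
chord⇒LeBound i k m p q l u h = ^-cancelˡ-≤ M {{m^n≢0 2 k}}
  (*-cancelʳ-≤ _ _ (2 ^ (M * p)) {{m^n≢0 2 (M * p)}} (begin
    (2 ^ (n * p)) ^ M * 2 ^ (M * p)
      ≡⟨ cong (_* 2 ^ (M * p)) (^-*-assoc 2 (n * p) M) ⟩
    2 ^ (n * p * M) * 2 ^ (M * p)
      ≡⟨ ^-distribˡ-+-* 2 (n * p * M) (M * p) ⟨
    2 ^ (n * p * M + M * p)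
      ≤⟨ ^-monoʳ-≤ 2 exponents ⟩
    2 ^ (n * q * M + (k * M + m) * p)
      ≡⟨ ^-distribˡ-+-* 2 (n * q * M) _ ⟩
    2 ^ (n * q * M) * 2 ^ ((k * M + m) * p)
      ≡⟨ cong₂ _*_ (^-*-assoc 2 (n * q) M) (^-*-assoc 2 (k * M + m) p) ⟨
    (2 ^ (n * q)) ^ M * (2 ^ (k * M + m)) ^ p
      ≤⟨ *-monoʳ-≤ ((2 ^ (n * q)) ^ M) (^-monoˡ-≤ p (log₂-chord k m l u)) ⟩
    (2 ^ (n * q)) ^ M * (m ^ M * 2 ^ M) ^ p
      ≡⟨ cong ((2 ^ (n * q)) ^ M *_) (^-distribʳ-* (m ^ M) (2 ^ M) p) ⟩
    (2 ^ (n * q)) ^ M * ((m ^ M) ^ p * (2 ^ M) ^ p)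
      ≡⟨ cong₂ (λ y z → (2 ^ (n * q)) ^ M * (y * z)) ^-swap (^-*-assoc 2 M p) ⟩
    (2 ^ (n * q)) ^ M * ((m ^ p) ^ M * 2 ^ (M * p))
      ≡⟨ *-assoc ((2 ^ (n * q)) ^ M) _ _ ⟨
    (2 ^ (n * q)) ^ M * (m ^ p) ^ M * 2 ^ (M * p)
      ≡⟨ cong (_* 2 ^ (M * p)) (^-distribʳ-* (2 ^ (n * q)) (m ^ p) M) ⟨
    (2 ^ (n * q) * m ^ p) ^ M * 2 ^ (M * p) ∎))
  where
  open ≤-Reasoning
  n = suc (i + k)
  M = 2 ^ k
  ^-swap : (m ^ M) ^ p ≡ (m ^ p) ^ M
  ^-swap = trans (^-*-assoc m M p) (trans (cong (m ^_) (*-comm M p)) (sym (^-*-assoc m p M)))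
  eq₁ : ∀ i k p M → suc (i + k) * p * M + M * p ≡ p * ((2 + i) * M) + k * M * p
  eq₁ = solve-∀
  eq₂ : ∀ x k p M m → x + p * m + k * M * p ≡ x + (k * M + m) * p
  eq₂ = solve-∀
  exponents : n * p * M + M * p ≤ n * q * M + (k * M + m) * p
  exponents = subst₂ _≤_ (sym (eq₁ i k p M)) (eq₂ (n * q * M) k p M m) (+-monoˡ-≤ (k * M * p) h)

card≤2^n : ∀ {n} (A : SubsetOf n) → card A ≤ 2 ^ n
card≤2^n {zero} A with A []
... | true  = ≤-refl
... | false = z≤n
card≤2^n {suc n} A = ≤-trans (≤-reflexive (sumCube-∷ (λ x → if A x then 1 else 0)))
  (+-mono-≤ (card≤2^n (A ∘ (false ∷_))) (≤-trans (card≤2^n (A ∘ (true ∷_))) (m≤m+n (2 ^ n) 0)))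

EY-bounded : ∀ {n} (A : SubsetOf n) → 1 ≤ card A → EY≤Bound A
EY-bounded {n} A 1≤m T with m≤n⇒m<n∨m≡n (card≤2^n A)
-- For the full cube the bound is trivial: `m ^ p` already equals the left side.
... | inj₂ m≡2^n = subst (λ m → LeBound n m (num A T) (den A T)) (sym m≡2^n)
  (≤-trans (≤-reflexive (sym (^-*-assoc 2 n (num A T))))
    (m≤n*m ((2 ^ n) ^ num A T) (2 ^ (n * den A T)) {{m^n≢0 2 (n * den A T)}}))
... | inj₁ m<2^n with dyadic-range n (card A) 1≤m m<2^n
...   | k , i , refl , l , u = chord⇒LeBound i k (card A) (num A T) (den A T) l u
  -- As `2 ^ n = 2 * 2 ^ i * 2 ^ k`, every term of `num-chord` has the factor `2 * 2 ^ i`.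
  (*-cancelˡ-≤ (2 * 2 ^ i) {{m^n≢0 2 (suc i)}} (subst₂ _≤_
    (eq₁ (num A T) i (2 ^ i) (2 ^ k)) (eq₂ (card A) (2 ^ i) (2 ^ k) (suc (i + k)) (suc (i + k) ^ T) (num A T))
    (subst (λ P → num A T * ((2 + i) * (2 * P))
                    ≤ card A * (2 * P) * suc (i + k) ^ suc T + num A T * (2 * 2 ^ i * card A))
      (^-distribˡ-+-* 2 i k) (num-chord (suc (i + k)) i A T))))
  where
  eq₁ : ∀ p i w M → p * ((2 + i) * (2 * (w * M))) ≡ 2 * w * (p * ((2 + i) * M))
  eq₁ = solve-∀
  eq₂ : ∀ m w M n N p → m * (2 * (w * M)) * (n * N) + p * (2 * w * m) ≡ 2 * w * (n * (m * N) * M + p * m)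
  eq₂ = solve-∀

-- Subcubes and geometric sums.

free : ∀ {n} → Vec (Maybe Bool) n → ℕ
free []            = 0
free (nothing ∷ s) = suc (free s)
free (just _ ∷ s)  = free s

free≤n : ∀ {n} (s : Vec (Maybe Bool) n) → free s ≤ n
free≤n []            = z≤n
free≤n (nothing ∷ s) = s≤s (free≤n s)
free≤n (just _ ∷ s)  = m≤n⇒m≤1+n (free≤n s)

-- Flipping a free coordinate stays in the subcube; flipping a fixed one leaves it.
neighbours-subcube : ∀ {n} (s : Vec (Maybe Bool) n) c x → inSubcube s x ≡ true →
  neighbours (λ y → if inSubcube s y then c else 0) x ≡ free s * c
neighbours-subcube [] c [] _ = refl
neighbours-subcube (nothing ∷ s) c (b ∷ x) x∈s =
  trans (neighbours-∷ (λ y → if inSubcube (nothing ∷ s) y then c else 0) b x)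
  (cong₂ _+_ (cong (λ a → if a then c else 0) x∈s) (neighbours-subcube s c x x∈s))
neighbours-subcube (just true ∷ s) c (true ∷ x) x∈s =
  trans (neighbours-∷ (λ y → if inSubcube (just true ∷ s) y then c else 0) true x) (neighbours-subcube s c x x∈s)
neighbours-subcube (just false ∷ s) c (false ∷ x) x∈s =
  trans (neighbours-∷ (λ y → if inSubcube (just false ∷ s) y then c else 0) false x) (neighbours-subcube s c x x∈s)

sumCube-cong : ∀ {n} {f g : Cube n → ℕ} → (∀ x → f x ≡ g x) → sumCube f ≡ sumCube g
sumCube-cong {n} h = cong sum (map-cong h (allCube n))

sumCube-subcube : ∀ {n} (s : Vec (Maybe Bool) n) c →
  sumCube (λ x → if inSubcube s x then c else 0) ≡ c * 2 ^ free s
sumCube-subcube [] c = trans (+-identityʳ c) (sym (*-identityʳ c))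
sumCube-subcube (nothing ∷ s) c = trans (sumCube-∷ (λ x → if inSubcube (nothing ∷ s) x then c else 0))
  (trans (cong₂ _+_ (sumCube-subcube s c) (sumCube-subcube s c)) (eq c (2 ^ free s)))
  where
  eq : ∀ c P → c * P + c * P ≡ c * (2 * P)
  eq = solve-∀
sumCube-subcube {suc n} (just true ∷ s) c =
  trans (sumCube-∷ (λ x → if inSubcube (just true ∷ s) x then c else 0))
    (cong₂ _+_ (sum-map-zero (allCube n)) (sumCube-subcube s c))
sumCube-subcube {suc n} (just false ∷ s) c =
  trans (sumCube-∷ (λ x → if inSubcube (just false ∷ s) x then c else 0))
    (trans (cong₂ _+_ (sumCube-subcube s c) (sum-map-zero (allCube n))) (+-identityʳ _))

-- The mean number of visits before time T, scaled by n ^ T, when each step stays inside with probability k / n.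
geometric : ℕ → ℕ → ℕ → ℕ
geometric k n T = sum (map (λ t → k ^ t * n ^ (T ∸ t)) (upTo T))

geometric-suc : ∀ k n T → geometric k n (suc T) ≡ n ^ suc T + k * geometric k n T
geometric-suc k n T = cong₂ _+_ (*-identityˡ (n ^ suc T)) (begin
  sum (map (λ t → k ^ t * n ^ (suc T ∸ t)) (applyUpTo suc T))
    ≡⟨ cong sum (trans (map-applyUpTo suc _ T) (sym (map-upTo _ T))) ⟩
  sum (map (λ t → k * k ^ t * n ^ (T ∸ t)) (upTo T))
    ≡⟨ cong sum (map-cong (λ t → eq k (k ^ t) (n ^ (T ∸ t))) (upTo T)) ⟩
  sum (map (λ t → k ^ t * n ^ (T ∸ t) * k) (upTo T))
    ≡⟨ sum-map-*ʳ _ k (upTo T) ⟩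
  geometric k n T * k
    ≡⟨ *-comm (geometric k n T) k ⟩
  k * geometric k n T ∎)
  where
  open ≡-Reasoning
  eq : ∀ k x y → k * x * y ≡ x * y * k
  eq = solve-∀

-- The finite geometric series without subtraction: for `d > 0`, `geometric k n T / n ^ T` falls
-- short of `n / d` by a multiple of `(k / n) ^ T`.
geometric-closed : ∀ k d T → let n = k + d in d * geometric k n T + n * k ^ T ≡ n * n ^ T
geometric-closed k d zero    = cong (_+ (k + d) * 1) (*-zeroʳ d)
geometric-closed k d (suc T) rewrite geometric-suc k (k + d) T = begin
  d * (n ^ suc T + k * G) + n * (k * k ^ T)  ≡⟨ eq₁ d (n ^ suc T) k G n (k ^ T) ⟩
  d * n ^ suc T + k * (d * G + n * k ^ T)    ≡⟨ cong (λ z → d * n ^ suc T + k * z) (geometric-closed k d T) ⟩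
  d * n ^ suc T + k * (n * n ^ T)            ≡⟨ eq₂ d k (n * n ^ T) ⟩
  n * n ^ suc T                              ∎
  where
  open ≡-Reasoning
  n = k + d
  G = geometric k n T
  eq₁ : ∀ d N k G n K → d * (N + k * G) + n * (k * K) ≡ d * N + k * (d * G + n * K)
  eq₁ = solve-∀
  eq₂ : ∀ d k N → d * N + k * N ≡ (k + d) * N
  eq₂ = solve-∀

geometric-full : ∀ n T → geometric n n T ≡ T * n ^ T
geometric-full n zero    = refl
geometric-full n (suc T) = trans (geometric-suc n n T)
  (trans (cong (λ z → n ^ suc T + n * z) (geometric-full n T)) (cong (n ^ suc T +_) (eq n T (n ^ T))))
  where
  eq : ∀ n T N → n * (T * N) ≡ T * (n * N)
  eq = solve-∀

-- Bernoulli's inequality `(1 + 1/k)^T ≥ 1 + T/k` with denominators cleared.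
bernoulli : ∀ k T → k ^ T * (k + T) ≤ k * suc k ^ T
bernoulli k zero    = ≤-reflexive (trans (+-identityʳ (k + 0)) (trans (+-identityʳ k) (sym (*-identityʳ k))))
bernoulli k (suc T) = begin
  k * k ^ T * (k + suc T)           ≡⟨ eq₁ k (k ^ T) T ⟩
  k ^ T * (k * (k + suc T))         ≤⟨ *-monoʳ-≤ (k ^ T) (m≤m+n _ T) ⟩
  k ^ T * (k * (k + suc T) + T)     ≡⟨ eq₂ k (k ^ T) T ⟩
  k ^ T * (k + T) * suc k           ≤⟨ *-monoˡ-≤ (suc k) (bernoulli k T) ⟩
  k * suc k ^ T * suc k             ≡⟨ eq₃ k (suc k ^ T) ⟩
  k * (suc k * suc k ^ T)           ∎
  where
  open ≤-Reasoning
  eq₁ : ∀ k K T → k * K * (k + suc T) ≡ K * (k * (k + suc T))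
  eq₁ = solve-∀
  eq₂ : ∀ k K T → K * (k * (k + suc T) + T) ≡ K * (k + T) * suc k
  eq₂ = solve-∀
  eq₃ : ∀ k N → k * N * suc k ≡ k * (suc k * N)
  eq₃ = solve-∀

^-outgrows : ∀ k n c → k < n → ∃ λ T → c * k ^ T < n ^ T
^-outgrows zero n c 0<n = 1 , subst (_< n * 1) (sym (*-zeroʳ c)) (subst (0 <_) (sym (*-identityʳ n)) 0<n)
-- For `T = c * k`, Bernoulli gives `(1 + 1/k)^T ≥ 1 + c`.
^-outgrows k@(suc _) n c k<n = T , (begin-strict
  c * k ^ T      <⟨ m<n+m _ (m^n>0 k T) ⟩
  suc c * k ^ T  ≤⟨ *-cancelˡ-≤ k (≤-trans (≤-reflexive (eq k c (k ^ T))) (bernoulli k T)) ⟩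
  suc k ^ T      ≤⟨ ^-monoˡ-≤ T k<n ⟩
  n ^ T          ∎)
  where
  open ≤-Reasoning
  T = c * k
  eq : ∀ k c K → k * (suc c * K) ≡ K * (k + c * k)
  eq = solve-∀

geometric-exceeds : ∀ k d p q → 1 ≤ k + d → 0 < q → d * p < (k + d) * q →
  ∃ λ T → p * (k + d) ^ T < geometric k (k + d) T * q
-- With `d = 0` the walk never leaves and the partial sum is `T` itself, so `T = suc p` exceeds
-- `p / q`.
geometric-exceeds k zero p q 1≤n 0<q _ rewrite +-identityʳ k = suc p , (begin-strict
  p * k ^ suc p                  <⟨ *-monoˡ-< (k ^ suc p) {{m^n≢0 k (suc p) {{>-nonZero 1≤n}}}} (n<1+n p) ⟩
  suc p * k ^ suc p              ≡⟨ geometric-full k (suc p) ⟨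
  geometric k k (suc p)          ≤⟨ m≤m*n _ q {{>-nonZero 0<q}} ⟩
  geometric k k (suc p) * q      ∎)
  where open ≤-Reasoning
geometric-exceeds k d@(suc _) p q 1≤n 0<q dp<nq with ^-outgrows k (k + d) ((k + d) * q) (m<m+n k (s≤s z≤n))
-- `T` makes the missing tail `n * q * k ^ T` smaller than `n ^ T`, the gap of at least 1 between
-- `d * p` and `n * q` after scaling.
... | T , nqk^T<n^T = T , *-cancelˡ-< d _ _ (+-cancelʳ-< (n * q * k ^ T) _ _ (begin-strict
  d * (p * n ^ T) + n * q * k ^ T   <⟨ +-monoʳ-< (d * (p * n ^ T)) nqk^T<n^T ⟩
  d * (p * n ^ T) + n ^ T           ≡⟨ eq₁ d p (n ^ T) ⟩
  suc (d * p) * n ^ T               ≤⟨ *-monoˡ-≤ (n ^ T) dp<nq ⟩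
  n * q * n ^ T                     ≡⟨ eq₂ n q (n ^ T) ⟩
  n * n ^ T * q                     ≡⟨ cong (_* q) (geometric-closed k d T) ⟨
  (d * G + n * k ^ T) * q           ≡⟨ eq₃ d G n (k ^ T) q ⟩
  d * (G * q) + n * q * k ^ T       ∎))
  where
  open ≤-Reasoning
  n = k + d
  G = geometric k n T
  eq₁ : ∀ d p N → d * (p * N) + N ≡ suc (d * p) * N
  eq₁ = solve-∀
  eq₂ : ∀ n q N → n * q * N ≡ n * N * q
  eq₂ = solve-∀
  eq₃ : ∀ d G n K q → (d * G + n * K) * q ≡ d * (G * q) + n * q * K
  eq₃ = solve-∀

-- Exit times from subcubes: equality and maximality.

module _ {n} (C : SubsetOf n) (s : Vec (Maybe Bool) n) (C≡s : ∀ x → C x ≡ inSubcube s x) where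

  private
    k = free s
    d = n ∸ free s
    k+d≡n : k + d ≡ n
    k+d≡n = m+[n∸m]≡n (free≤n s)

  stay-subcube : ∀ t x → stay C t x ≡ (if inSubcube s x then k ^ t else 0)
  stay-subcube zero    x rewrite C≡s x = refl
  stay-subcube (suc t) x rewrite C≡s x with inSubcube s x in x∈s
  ... | false = refl
  ... | true  = trans (cong sum (map-cong (λ i → stay-subcube t (flipAt i x)) (allFin n)))
    (neighbours-subcube s (k ^ t) x x∈s)

  card-subcube : card C ≡ 2 ^ k
  card-subcube = trans (sumCube-cong (stay-subcube 0)) (trans (sumCube-subcube s 1) (*-identityˡ (2 ^ k)))

  num-subcube : ∀ T → num C T ≡ geometric k n T * 2 ^ k
  num-subcube T = trans (cong sum (map-cong term (upTo T))) (sum-map-*ʳ _ (2 ^ k) (upTo T))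
    where
    eq : ∀ K P N → K * P * N ≡ K * N * P
    eq = solve-∀
    term : ∀ t → sumCube (stay C t) * n ^ (T ∸ t) ≡ k ^ t * n ^ (T ∸ t) * 2 ^ k
    term t = trans (cong (_* n ^ (T ∸ t)) (trans (sumCube-cong (stay-subcube t)) (sumCube-subcube s (k ^ t))))
      (eq (k ^ t) (2 ^ k) (n ^ (T ∸ t)))

  EY-subcube-exceeds : 1 ≤ n → ∀ p q → 0 < q → d * p < n * q → ∃ λ T → p * den C T < num C T * q
  EY-subcube-exceeds 1≤n p q 0<q dp<nq
    with geometric-exceeds k d p q (subst (1 ≤_) (sym k+d≡n) 1≤n) 0<q
           (subst (λ z → d * p < z * q) (sym k+d≡n) dp<nq)
  ... | T , h = T , subst₂ _<_
    (trans (eq₁ p (n ^ T) (2 ^ k)) (cong (λ z → p * (z * n ^ T)) (sym card-subcube)))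
    (trans (eq₂ (geometric k n T) q (2 ^ k)) (cong (_* q) (sym (num-subcube T))))
    (*-monoˡ-< (2 ^ k) {{m^n≢0 2 k}} (subst (λ z → p * z ^ T < geometric k z T * q) k+d≡n h))
    where
    eq₁ : ∀ p N P → p * N * P ≡ p * (P * N)
    eq₁ = solve-∀
    eq₂ : ∀ G q P → G * q * P ≡ G * P * q
    eq₂ = solve-∀

  private
    exponent : ∀ p q → 2 ^ (n * q) * (2 ^ k) ^ p ≡ 2 ^ (n * q + k * p)
    exponent p q = trans (cong (2 ^ (n * q) *_) (^-*-assoc 2 k p)) (sym (^-distribˡ-+-* 2 (n * q) (k * p)))

    np≡ : ∀ p → n * p ≡ d * p + k * p
    np≡ p = trans (cong (_* p) (trans (sym k+d≡n) (+-comm k d))) (*-distribʳ-+ p d k)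

  -- For `2 ^ k` points the logarithm is the integer `d = n - k`, so the bound is `n / d` and only
  -- exponents of 2 are compared.
  LtBound⇒< : ∀ p q → LtBound n (2 ^ k) p q → d * p < n * q
  LtBound⇒< p q h = +-cancelʳ-< (k * p) _ _ (subst (_< n * q + k * p) (np≡ p)
    (≰⇒> λ le → <⇒≱ (subst (2 ^ (n * p) <_) (exponent p q) h) (^-monoʳ-≤ 2 le)))

  LeBound⇒≤ : ∀ p q → LeBound n (2 ^ k) p q → d * p ≤ n * q
  LeBound⇒≤ p q h = +-cancelʳ-≤ (k * p) _ _ (subst (_≤ n * q + k * p) (np≡ p)
    (^-cancelʳ-≤ (subst (2 ^ (n * p) ≤_) (exponent p q) h)))

  subcube-attains : 1 ≤ n → EY≥Bound C
  subcube-attains 1≤n p q 0<q h =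
    EY-subcube-exceeds 1≤n p q 0<q (LtBound⇒< p q (subst (λ m → LtBound n m p q) card-subcube h))

  -- The partial sums for `A` are at most `n / d` by `EY-bounded`, so any `p / q` below one of them
  -- is below `n / d`, the value that the partial sums for `C` approach.
  subcube-maximal : 1 ≤ n → (A : SubsetOf n) → 1 ≤ card A → card C ≡ card A → EY≤EY A C
  subcube-maximal 1≤n A 1≤m C≡A p q 0<q T pD<Nq = EY-subcube-exceeds 1≤n p q 0<q dp<nq
    where
    dN≤nD : d * num A T ≤ n * den A T
    dN≤nD = LeBound⇒≤ (num A T) (den A T)
      (subst (λ m → LeBound n m (num A T) (den A T)) (trans (sym C≡A) card-subcube) (EY-bounded A 1≤m T))
    eq₁ : ∀ d p D → d * p * D ≡ d * (p * D)
    eq₁ = solve-∀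
    eq₂ : ∀ n D q → n * D * q ≡ n * q * D
    eq₂ = solve-∀
    -- Stated for a variable `d′` to allow case analysis: at 0, which is the full cube, the claim is
    -- just `0 < n * q`.
    lemma : ∀ d′ → d′ * num A T ≤ n * den A T → d′ * p < n * q
    lemma zero     _ = *-mono-< {0} {n} {0} {q} 1≤n 0<q
    lemma d′@(suc _) le = *-cancelʳ-< (den A T) (d′ * p) (n * q) (begin-strict
      d′ * p * den A T      ≡⟨ eq₁ d′ p (den A T) ⟩
      d′ * (p * den A T)    <⟨ *-monoʳ-< d′ pD<Nq ⟩
      d′ * (num A T * q)    ≡⟨ *-assoc d′ (num A T) q ⟨
      d′ * num A T * q      ≤⟨ *-monoˡ-≤ q le ⟩
      n * den A T * q       ≡⟨ eq₂ n (den A T) q ⟩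
      n * q * den A T       ∎)
      where open ≤-Reasoning
    dp<nq : d * p < n * q
    dp<nq = lemma d dN≤nD

theorem1p2 : (n : ℕ) → 1 ≤ n → (A : SubsetOf n) → 1 ≤ card A →
    EY≤Bound A
    × (IsSubcube A → EY≥Bound A)
    × ((C : SubsetOf n) → IsSubcube C → card C ≡ card A → EY≤EY A C)
theorem1p2 n 1≤n A 1≤m =
    EY-bounded A 1≤m
  , (λ (s , A≡s) → subcube-attains A s A≡s 1≤n)
  , (λ C (s , C≡s) C≡A → subcube-maximal C s C≡s 1≤n A 1≤m C≡A)
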